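{- Let $\Delta$ be a finite polar space of rank $n\ge 3$ and order $(s,\dots,s,t)$, and let $(n-2)/2\le i<j\le n-1$. Then $(\Delta_i,\perp)\not\cong(\Delta_j,\perp)$, $(\Delta_i,\perp\cup\approx)\not\cong(\Delta_j,\perp\cup\approx)$ and $(\Delta_i,\perp_{\max})\not\cong(\Delta_j,\perp_{\max})$.
   Context: $\Delta$ is a finite non-degenerate polar space of rank $n\ge3$ of order $(s,\dots,s,t)$: $s,t$ are positive integers with $s>1$ and $t\in\{1,s^{1/2},s,s^{3/2},s^2\}$, every line has $s+1$ points and every singular subspace of projective dimension $n-2$ lies in exactly $t+1$ maximal singular subspaces (which have projective dimension $n-1$). $\Delta_u$ is the set of singular subspaces of projective dimension $u$. For $X,Y\in\Delta_u$: $X\perp Y$ means every point of $X$ is collinear with every point of $Y$; $X\approx Y$ means $\dim(X\cap Y)=u-1$; $X\perp_{\max}Y$ means $X\perp Y$ and $\dim\langle X,Y\rangle=n-1$. $(\Delta_u,\perp)$, $(\Delta_u,\perp\cup\approx)$, $(\Delta_u,\perp_{\max})$ are the graphs on vertex set $\Delta_u$ in which distinct $X,Y$ are adjacent iff respectively $X\perp Y$; $X\perp Y$ or $X\approx Y$; $X\perp_{\max}Y$. -}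

module Defs where

open import Data.Nat using (ℕ; zero; suc; _+_; _*_; _∸_; _≤_; _<_)
open import Data.Fin using (Fin)
open import Data.Fin.Subset using (Subset; _∈_; _⊆_; _⊂_; _∩_; _∪_; ∣_∣; Nonempty)
open import Data.Product using (Σ; ∃; _×_; _,_)
open import Data.Sum using (_⊎_)
open import Relation.Nullary using (¬_)
open import Relation.Binary.PropositionalEquality using (_≡_; _≢_)

-- A finite point-line geometry: points are Fin N, lines are indexed by Fin NL,
-- and pts ℓ is the set of points on line ℓ.
record Geometry : Set where
  field
    N   : ℕ
    NL  : ℕ
    pts : Fin NL → Subset N

_⇔_ : Set → Set → Set
A ⇔ B = (A → B) × (B → A)

Iso : {S : Set} → (S → Set) → (S → S → Set) → (S → Set) → (S → S → Set) → Set
Iso {S} V₁ A₁ V₂ A₂ =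
  Σ (S → S) λ f → Σ (S → S) λ g →
    (∀ X → V₁ X → V₂ (f X)) ×
    (∀ Y → V₂ Y → V₁ (g Y)) ×
    (∀ X → V₁ X → g (f X) ≡ X) ×
    (∀ Y → V₂ Y → f (g Y) ≡ Y) ×
    (∀ X Y → V₁ X → V₁ Y → A₁ X Y ⇔ A₂ (f X) (f Y))

Adj : {S : Set} → (S → S → Set) → S → S → Set
Adj R X Y = X ≢ Y × R X Y

module _ (G : Geometry) where
  open Geometry G

  Collinear : Fin N → Fin N → Set
  Collinear p q = p ≡ q ⊎ ∃ λ ℓ → p ∈ pts ℓ × q ∈ pts ℓ

  Singular : Subset N → Set
  Singular X =
    (∀ p q → p ∈ X → q ∈ X → Collinear p q) ×
    (∀ ℓ p q → p ≢ q → p ∈ pts ℓ → q ∈ pts ℓ → p ∈ X → q ∈ X → pts ℓ ⊆ X)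

  Chain : Subset N → ℕ → Set
  Chain X zero    = Singular X × Nonempty X
  Chain X (suc k) = Singular X × ∃ λ Y → Y ⊂ X × Chain Y k

  -- projective dimension of a (nonempty) singular subspace
  Dim : Subset N → ℕ → Set
  Dim X d = Chain X d × ¬ Chain X (suc d)

  Δ : ℕ → Subset N → Set
  Δ u X = Singular X × Dim X u

  Perp : Subset N → Subset N → Set
  Perp X Y = ∀ p q → p ∈ X → q ∈ Y → Collinear p q

  -- X ≈ Y for X, Y ∈ Δ_u (used only for u ≥ 1): dim (X ∩ Y) = u - 1
  Approx : ℕ → Subset N → Subset N → Set
  Approx u X Y = Dim (X ∩ Y) (u ∸ 1)

  Span : Subset N → Subset N → Subset N → Set
  Span X Y Z = Singular Z × (X ∪ Y) ⊆ Z ×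
               (∀ W → Singular W → (X ∪ Y) ⊆ W → Z ⊆ W)

  PerpMax : ℕ → Subset N → Subset N → Set
  PerpMax n X Y = Perp X Y × ∃ λ Z → Span X Y Z × Dim Z (n ∸ 1)

  record IsPolarSpaceOfOrder (n s t : ℕ) : Set where
    field
      partialLinear : ∀ ℓ m p q → p ≢ q → p ∈ pts ℓ → q ∈ pts ℓ →
                      p ∈ pts m → q ∈ pts m → ℓ ≡ m
      oneOrAll : ∀ p ℓ →
        (∀ q → q ∈ pts ℓ → Collinear p q) ⊎
        ((∃ λ q → q ∈ pts ℓ × Collinear p q) ×
         (∀ q q' → q ∈ pts ℓ → q' ∈ pts ℓ → Collinear p q → Collinear p q' → q ≡ q'))
      nondegenerate : ∀ p → ∃ λ q → ¬ Collinear p q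
      rank-ex  : ∃ λ X → Δ (n ∸ 1) X
      rank-max : ∀ X → ¬ Chain X n
      lineSize : ∀ ℓ → ∣ pts ℓ ∣ ≡ suc s
      maxThrough : ∀ Y → Δ (n ∸ 2) Y →
        Σ (Fin (suc t) → Subset N) λ e →
          (∀ k k' → e k ≡ e k' → k ≡ k') ×
          (∀ Z → (Δ (n ∸ 1) Z × Y ⊆ Z) ⇔ (∃ λ k → e k ≡ Z))
      s>1 : 1 < s
      t-values : t ≡ 1 ⊎ t * t ≡ s ⊎ t ≡ s ⊎ t * t ≡ s * s * s ⊎ t ≡ s * s

{-# OPTIONS --safe #-}
module Submission where

-- All three graphs are regular, and their valencies strictly decrease with the dimension u in the
-- range (n−2)/2 ≤ u ≤ n−1.  Write [r] = 1 + s + … + s^(r−1), let X have vector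
-- dimension m = n − k, and let Q_c be the number of points of a polar space of rank c and order
-- (s,…,s,t), so that Q_(c+1) = 1 + s Q_c + t s^(2c).  The number of Y ⊥ X of dimension m with
-- dim (X ∩ Y) = m − a is
--     A_a(k) = s^(a²) · [m] [m−1] ⋯ [m−a+1] · Q_k Q_(k−1) ⋯ Q_(k−a+1) / ([a]!)²,
-- and the number of Y ≈ X with Y ⊥̸ X is [m] · t s^(2k).  The valencies are therefore, up to
-- excluding X itself, the sum of the A_a(k), that sum plus [m] t s^(2k), and A_k(k).  Since
-- [m+1] Q_c ≤ [m] Q_(c+1), each A_a(k) is at most A_a(k+1).
-- For the geometry, a singular subspace X satisfies X = X^⊥⊥; hence the union of the lines joining
-- a point p ∈ X^⊥ ∖ X to X is a subspace of 1 + s|X| points, and the dimension of a singular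
-- subspace can be read off from its number of points.

open import Defs
open import Algebra.Properties.CommutativeSemigroup using (interchange)
import Data.Bool.Properties as Boolₚ
open import Data.Empty using (⊥-elim)
open import Data.Fin using (Fin; zero; suc)
import Data.Fin.Properties as Finₚ
open import Data.Fin.Subset using (Subset; _∈_; _⊆_; ∣_∣; _∩_; _∪_; inside; outside) renaming (⊥ to ∅)
open import Data.Fin.Subset.Properties using (_∈?_; _⊆?_; drop-there; ⊆-antisym; ∉⊥; x∈p∩q⁺; x∈p∩q⁻; x∈p∪q⁺; x∈p∪q⁻; p∩q⊆p; p∩q⊆q; ∩-idem; ∩-comm)
open import Data.List using (List; []; _∷_; _++_; map)
import Data.Nat as ℕ
open import Data.Nat using (ℕ; zero; suc; _+_; _*_; _∸_; _^_; _≤_; _<_; z≤n; s≤s; s≤s⁻¹; NonZero; >-nonZero; ≢-nonZero⁻¹)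
open import Data.Nat.Properties hiding (_≟_)
open import Data.Nat.Tactic.RingSolver using (solve-∀)
open import Data.Product using (∃; _×_; _,_; proj₁; proj₂)
open import Data.Sum using (_⊎_; inj₁; inj₂)
open import Data.Unit using (⊤; tt)
open import Data.Vec using ([]; _∷_; there; tabulate)
import Data.Vec.Properties as Vecₚ
open import Function using (_∘_; case_of_)
open import Relation.Binary.PropositionalEquality hiding (J)
open import Relation.Nullary using (¬_; Dec; yes; no; does; ¬?; _×-dec_; _⊎-dec_; _→-dec_)
open import Relation.Nullary.Decidable using (dec-true; decidable-stable; map′)

-- The inequalities A_a(k) ≤ A_a(k+1) alone leave room for equality. It is excluded by comparing
-- only consecutive ranks m + 1 = n - k and m: the lower bound on i becomes k + 1 ≤ m, so a subspace
-- of rank m has perpendicular partners in class a = k + 1, whereas a subspace of rank m + 1, having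
-- corank k, has none. The third graph is harder, because its valencies A_k(k) and A_(k+1)(k+1) sit
-- at different a; there the gain s^(2k+1) Q_1 [m-k] has to beat the new denominator [k+1]².
-- Residues X^⊥/X are never formed as geometries: the counts are of points and subspaces of the
-- ambient space, and carry a power of s for it. Quotients are not formed either; denominators stay
-- on the other side of each equation and are cancelled when two counts are compared.

record DecPred (A : Set) : Set₁ where
  constructor _by_
  field
    Holds : A → Set
    dec   : ∀ a → Dec (Holds a)
open DecPred public

infixr 6 _∧_
_∧_ : ∀ {A} → DecPred A → DecPred A → DecPred A
P ∧ Q = (λ a → Holds P a × Holds Q a) by (λ a → dec P a ×-dec dec Q a)

infixr 5 _∨_
_∨_ : ∀ {A} → DecPred A → DecPred A → DecPred A
P ∨ Q = (λ a → Holds P a ⊎ Holds Q a) by (λ a → dec P a ⊎-dec dec Q a)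

∁ : ∀ {A} → DecPred A → DecPred A
∁ P = (λ a → ¬ Holds P a) by (λ a → ¬? (dec P a))

-- Counting in enumerated finite types

ι : {P : Set} → Dec P → ℕ
ι (yes _) = 1
ι (no _)  = 0

ι-cong : {P Q : Set} (p : Dec P) (q : Dec Q) → (P → Q) → (Q → P) → ι p ≡ ι q
ι-cong (yes _) (yes _) f g = refl
ι-cong (yes p) (no ¬q) f g = ⊥-elim (¬q (f p))
ι-cong (no ¬p) (yes q) f g = ⊥-elim (¬p (g q))
ι-cong (no _)  (no _)  f g = refl

ι-no : {P : Set} (p : Dec P) → ¬ P → ι p ≡ 0
ι-no (yes p) ¬p = ⊥-elim (¬p p)
ι-no (no _)  _  = refl

sumOver : {A : Set} → (A → ℕ) → List A → ℕ
sumOver f []       = 0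
sumOver f (x ∷ xs) = f x + sumOver f xs

sumOver-cong : ∀ {A} {f g : A → ℕ} (xs : List A) → (∀ a → f a ≡ g a) → sumOver f xs ≡ sumOver g xs
sumOver-cong []       h = refl
sumOver-cong (x ∷ xs) h = cong₂ _+_ (h x) (sumOver-cong xs h)

sumOver-+ : ∀ {A} (f g : A → ℕ) (xs : List A) → sumOver (λ a → f a + g a) xs ≡ sumOver f xs + sumOver g xs
sumOver-+ f g []       = refl
sumOver-+ f g (x ∷ xs) = trans (cong (f x + g x +_) (sumOver-+ f g xs)) (interchange +-commutativeSemigroup (f x) (g x) (sumOver f xs) (sumOver g xs))

sumOver-zero : ∀ {A} (xs : List A) → sumOver (λ _ → 0) xs ≡ 0
sumOver-zero []       = refl
sumOver-zero (x ∷ xs) = sumOver-zero xs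

sumOver-* : ∀ {A} (f : A → ℕ) c (xs : List A) → sumOver (λ a → f a * c) xs ≡ sumOver f xs * c
sumOver-* f c []       = refl
sumOver-* f c (x ∷ xs) = trans (cong (f x * c +_) (sumOver-* f c xs)) (sym (*-distribʳ-+ c (f x) (sumOver f xs)))

sumOver-swap : ∀ {A B : Set} (h : A → B → ℕ) xs ys →
  sumOver (λ a → sumOver (h a) ys) xs ≡ sumOver (λ b → sumOver (λ a → h a b) xs) ys
sumOver-swap h []       ys = sym (sumOver-zero ys)
sumOver-swap h (x ∷ xs) ys = trans (cong (sumOver (h x) ys +_) (sumOver-swap h xs ys))
  (sym (sumOver-+ (h x) (λ b → sumOver (λ a → h a b) xs) ys))

sumOver-++ : ∀ {A} (f : A → ℕ) xs ys → sumOver f (xs ++ ys) ≡ sumOver f xs + sumOver f ys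
sumOver-++ f []       ys = refl
sumOver-++ f (x ∷ xs) ys = trans (cong (f x +_) (sumOver-++ f xs ys)) (sym (+-assoc (f x) _ _))

sumOver-map : ∀ {A B : Set} (f : B → ℕ) (g : A → B) xs → sumOver f (map g xs) ≡ sumOver (f ∘ g) xs
sumOver-map f g []       = refl
sumOver-map f g (x ∷ xs) = cong (f (g x) +_) (sumOver-map f g xs)

countIn : ∀ {A} → DecPred A → List A → ℕ
countIn P = sumOver (λ a → ι (dec P a))

-- `once` expresses in one equation that `univ` misses no element and repeats none.
record Finite (A : Set) : Set where
  field
    univ : List A
    _≟_  : (a b : A) → Dec (a ≡ b)
    once : ∀ a → countIn ((_≡ a) by (_≟ a)) univ ≡ 1
open Finite {{...}} public using (univ; _≟_; once)

is : ∀ {A} {{_ : Finite A}} → A → DecPred A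
is a = (_≡ a) by (_≟ a)

module _ {A : Set} {{_ : Finite A}} where

  opaque
    # : DecPred A → ℕ
    # P = countIn P univ

    #≡countIn : ∀ P → # P ≡ countIn P univ
    #≡countIn P = refl

  #-cong : ∀ P Q → (∀ a → Holds P a → Holds Q a) → (∀ a → Holds Q a → Holds P a) → # P ≡ # Q
  #-cong P Q f g = trans (#≡countIn P) (trans
    (sumOver-cong univ (λ a → ι-cong (dec P a) (dec Q a) (f a) (g a))) (sym (#≡countIn Q)))

  #-is : ∀ a → # (is a) ≡ 1
  #-is a = trans (#≡countIn (is a)) (once a)

  #-unique : ∀ P a → Holds P a → (∀ b → Holds P b → b ≡ a) → # P ≡ 1
  #-unique P a pa u = trans (#-cong P (is a) u (λ { b refl → pa })) (#-is a)

  #-empty : ∀ P → (∀ a → ¬ Holds P a) → # P ≡ 0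
  #-empty P e = trans (#≡countIn P) (trans (sumOver-cong univ (λ a → ι-no (dec P a) (e a))) (sumOver-zero univ))

  #-split : ∀ P Q → # P ≡ # (P ∧ Q) + # (P ∧ ∁ Q)
  #-split P Q = trans (#≡countIn P) (trans (sumOver-cong univ pointwise) (trans (sumOver-+ _ _ univ)
    (sym (cong₂ _+_ (#≡countIn (P ∧ Q)) (#≡countIn (P ∧ ∁ Q))))))
    where
    pointwise : ∀ a → ι (dec P a) ≡ ι (dec (P ∧ Q) a) + ι (dec (P ∧ ∁ Q) a)
    pointwise a with dec P a | dec Q a
    ... | yes _ | yes _ = refl
    ... | yes _ | no _  = refl
    ... | no _  | yes _ = refl
    ... | no _  | no _  = refl

  #-relative : ∀ P Q → (∀ a → Holds Q a → Holds P a) → # P ≡ # Q + # (P ∧ ∁ Q)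
  #-relative P Q Q⇒P = trans (#-split P Q)
    (cong (_+ # (P ∧ ∁ Q)) (#-cong (P ∧ Q) Q (λ _ → proj₂) (λ a q → Q⇒P a q , q)))

  #-mono : ∀ P Q → (∀ a → Holds P a → Holds Q a) → # P ≤ # Q
  #-mono P Q f = subst (# P ≤_) (sym (#-relative Q P f)) (m≤m+n _ _)

  #-pos : ∀ P a → Holds P a → 0 < # P
  #-pos P a pa = subst (_≤ # P) (#-is a) (#-mono (is a) P (λ { b refl → pa }))

  #-strict : ∀ P Q → (∀ a → Holds P a → Holds Q a) → ∀ a → Holds Q a → ¬ Holds P a → # P < # Q
  #-strict P Q f a qa ¬pa = subst (# P <_) (sym (#-relative Q P f))
    (subst (_≤ # P + # (Q ∧ ∁ P)) (+-comm (# P) 1) (+-monoʳ-≤ (# P) (#-pos (Q ∧ ∁ P) a (qa , ¬pa))))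

module _ {A B : Set} {{_ : Finite A}} {{_ : Finite B}} where

  -- The factor u lets the row counts be known only after clearing a denominator.
  opaque
    unfolding #
    double-count : (P : DecPred A) (Q : DecPred B) (R : A → DecPred B) (u c d : ℕ) →
      (∀ a → Holds P a → # (Q ∧ R a) * u ≡ c) →
      (∀ b → Holds Q b → # (P ∧ ((λ a → Holds (R a) b) by (λ a → dec (R a) b))) ≡ d) →
      # P * c ≡ # Q * d * u
    double-count P Q R u c d row col = begin
      # P * c                                            ≡⟨ sym (sumOver-* (λ a → ι (dec P a)) c (univ {A})) ⟩
      sumOver (λ a → ι (dec P a) * c) univ               ≡⟨ sumOver-cong univ rowSum ⟩
      sumOver (λ a → sumOver (h a) univ * u) univ        ≡⟨ sumOver-* (λ a → sumOver (h a) univ) u (univ {A}) ⟩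
      sumOver (λ a → sumOver (h a) univ) univ * u        ≡⟨ cong (_* u) (sumOver-swap h univ univ) ⟩
      sumOver (λ b → sumOver (λ a → h a b) univ) univ * u ≡⟨ cong (_* u) (sumOver-cong univ colSum) ⟩
      sumOver (λ b → ι (dec Q b) * d) univ * u           ≡⟨ cong (_* u) (sumOver-* (λ b → ι (dec Q b)) d (univ {B})) ⟩
      # Q * d * u ∎
      where
      open ≡-Reasoning
      h : A → B → ℕ
      h a b = ι (dec P a ×-dec (dec Q b ×-dec dec (R a) b))
      rowSum : ∀ a → ι (dec P a) * c ≡ sumOver (h a) univ * u
      rowSum a with dec P a in eq
      ... | yes p = trans (+-identityʳ c) (trans (sym (row a p)) (cong (_* u) (sumOver-cong univ λ b →
            ι-cong (dec (Q ∧ R a) b) (yes p ×-dec (dec Q b ×-dec dec (R a) b)) (p ,_) proj₂)))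
      ... | no ¬p = cong (_* u) (sym (trans (sumOver-cong univ λ b →
            ι-no (no ¬p ×-dec (dec Q b ×-dec dec (R a) b)) (λ z → ¬p (proj₁ z))) (sumOver-zero (univ {B}))))
      colSum : ∀ b → sumOver (λ a → h a b) univ ≡ ι (dec Q b) * d
      colSum b with dec Q b
      ... | yes q = trans (trans (sumOver-cong univ λ a →
            ι-cong (dec P a ×-dec (yes q ×-dec dec (R a) b)) (dec P a ×-dec dec (R a) b)
              (λ { (p , _ , r) → p , r }) (λ { (p , r) → p , q , r })) (col b q)) (sym (+-identityʳ d))
      ... | no ¬q = trans (sumOver-cong univ λ a →
            ι-no (dec P a ×-dec (no ¬q ×-dec dec (R a) b)) (λ z → ¬q (proj₁ (proj₂ z)))) (sumOver-zero (univ {A}))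

  #-bijection : (P : DecPred A) (Q : DecPred B) (f : A → B) (g : B → A) →
    (∀ a → Holds P a → Holds Q (f a)) → (∀ b → Holds Q b → Holds P (g b)) →
    (∀ a → Holds P a → g (f a) ≡ a) → (∀ b → Holds Q b → f (g b) ≡ b) → # P ≡ # Q
  #-bijection P Q f g pf qg gf fg = begin
    # P         ≡⟨ sym (*-identityʳ _) ⟩
    # P * 1     ≡⟨ double-count P Q (λ a → is (f a)) 1 1 1
                   (λ a pa → trans (*-identityʳ _) (#-unique (Q ∧ is (f a)) (f a) (pf a pa , refl) (λ _ → proj₂)))
                   (λ b qb → #-unique _ (g b) (qg b qb , sym (fg b qb))
                     (λ { a (pa , refl) → sym (gf a pa) })) ⟩
    # Q * 1 * 1 ≡⟨ trans (*-identityʳ _) (*-identityʳ _) ⟩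
    # Q         ∎
    where open ≡-Reasoning

-- Points and point sets as finite types

allPoints : ∀ n → List (Fin n)
allPoints zero    = []
allPoints (suc n) = zero ∷ map suc (allPoints n)

allSubsets : ∀ n → List (Subset n)
allSubsets zero    = [] ∷ []
allSubsets (suc n) = map (inside ∷_) (allSubsets n) ++ map (outside ∷_) (allSubsets n)

_≟ˢ_ : ∀ {n} (X Y : Subset n) → Dec (X ≡ Y)
_≟ˢ_ = Vecₚ.≡-dec Boolₚ._≟_

point-once : ∀ {n} (p : Fin n) → countIn ((_≡ p) by (Finₚ._≟ p)) (allPoints n) ≡ 1
point-once {suc n} zero = cong suc (trans (sumOver-map _ suc (allPoints n))
  (trans (sumOver-cong (allPoints n) (λ a → ι-no (suc a Finₚ.≟ zero) (λ ()))) (sumOver-zero (allPoints n))))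
point-once {suc n} (suc p) = trans (sumOver-map _ suc (allPoints n))
  (trans (sumOver-cong (allPoints n) (λ a → ι-cong (suc a Finₚ.≟ suc p) (a Finₚ.≟ p) Finₚ.suc-injective (cong suc)))
    (point-once p))

subset-once : ∀ {n} (X : Subset n) → countIn ((_≡ X) by (_≟ˢ X)) (allSubsets n) ≡ 1
subset-once [] = refl
subset-once {suc n} (b ∷ X) = trans (sumOver-++ f (map (inside ∷_) (allSubsets n)) _)
  (trans (cong₂ _+_ (sumOver-map f (inside ∷_) (allSubsets n)) (sumOver-map f (outside ∷_) (allSubsets n))) (cases b refl))
  where
  f : Subset (suc n) → ℕ
  f Y = ι (Y ≟ˢ (b ∷ X))
  same : ∀ c → c ≡ b → sumOver (f ∘ (c ∷_)) (allSubsets n) ≡ 1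
  same c refl = trans (sumOver-cong (allSubsets n) (λ Y → ι-cong ((c ∷ Y) ≟ˢ (b ∷ X)) (Y ≟ˢ X) Vecₚ.∷-injectiveʳ (cong (c ∷_)))) (subset-once X)
  diff : ∀ c → c ≢ b → sumOver (f ∘ (c ∷_)) (allSubsets n) ≡ 0
  diff c ne = trans (sumOver-cong (allSubsets n) (λ Y → ι-no ((c ∷ Y) ≟ˢ (b ∷ X)) (ne ∘ Vecₚ.∷-injectiveˡ))) (sumOver-zero (allSubsets n))
  cases : ∀ c → c ≡ b → sumOver (f ∘ (inside ∷_)) (allSubsets n) + sumOver (f ∘ (outside ∷_)) (allSubsets n) ≡ 1
  cases inside  e = cong₂ _+_ (same inside e) (diff outside (λ o → case trans e (sym o) of λ ()))
  cases outside e = cong₂ _+_ (diff inside (λ i → case trans e (sym i) of λ ())) (same outside e)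

instance
  Finite-Fin : ∀ {n} → Finite (Fin n)
  Finite-Fin {n} = record { univ = allPoints n ; _≟_ = Finₚ._≟_ ; once = point-once }
  Finite-Subset : ∀ {n} → Finite (Subset n)
  Finite-Subset {n} = record { univ = allSubsets n ; _≟_ = _≟ˢ_ ; once = subset-once }

In : ∀ {n} → Subset n → DecPred (Fin n)
In X = (_∈ X) by (_∈? X)

size : ∀ {n} → Subset n → ℕ
size X = # (In X)

opaque
  unfolding #

  size-[] : size [] ≡ 0
  size-[] = refl

  size-cons : ∀ {n} b (X : Subset n) → size (b ∷ X) ≡ ι (zero ∈? (b ∷ X)) + size X
  size-cons {n} b X = cong (ι (zero ∈? (b ∷ X)) +_) (trans (sumOver-map _ suc (allPoints n))
    (sumOver-cong (allPoints n) (λ p → ι-cong (suc p ∈? (b ∷ X)) (p ∈? X) drop-there there)))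

∣∣≡size : ∀ {n} (X : Subset n) → ∣ X ∣ ≡ size X
∣∣≡size [] = sym size-[]
∣∣≡size (inside ∷ X)  = trans (cong suc (∣∣≡size X)) (sym (size-cons inside X))
∣∣≡size (outside ∷ X) = trans (∣∣≡size X) (sym (size-cons outside X))

everything : ∀ {A} → DecPred A
everything = (λ _ → ⊤) by (λ _ → yes tt)

opaque
  unfolding #

  #-everything : ∀ n → # {Fin n} everything ≡ n
  #-everything zero    = refl
  #-everything (suc n) = cong suc (trans (sumOver-map _ suc (allPoints n)) (#-everything n))

⟪_⟫ : ∀ {n} → DecPred (Fin n) → Subset n
⟪ P ⟫ = tabulate (λ p → does (dec P p))

∈⟪⟫⁺ : ∀ {n} (P : DecPred (Fin n)) {p} → Holds P p → p ∈ ⟪ P ⟫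
∈⟪⟫⁺ P {p} h = Vecₚ.lookup⇒[]= p _ (trans (Vecₚ.lookup∘tabulate _ p) (dec-true (dec P p) h))

∈⟪⟫⁻ : ∀ {n} (P : DecPred (Fin n)) {p} → p ∈ ⟪ P ⟫ → Holds P p
∈⟪⟫⁻ P {p} p∈ with dec P p | trans (sym (Vecₚ.lookup∘tabulate (λ q → does (dec P q)) p)) (Vecₚ.[]=⇒lookup p∈)
... | yes h | _ = h
... | no _  | ()

size-⊆ : ∀ {n} {X Y : Subset n} → X ⊆ Y → size X ≤ size Y
size-⊆ {X = X} {Y} X⊆Y = #-mono (In X) (In Y) (λ _ → X⊆Y)

⊈⇒∃ : ∀ {n} {X Y : Subset n} → ¬ Y ⊆ X → ∃ λ p → p ∈ Y × ¬ p ∈ X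
⊈⇒∃ {n} {X} {Y} Y⊈X with Finₚ.any? (λ p → p ∈? Y ×-dec ¬? (p ∈? X))
... | yes e = e
... | no ¬e = ⊥-elim (Y⊈X (λ {p} p∈Y → decidable-stable (p ∈? X) (λ p∉X → ¬e (p , p∈Y , p∉X))))

size-< : ∀ {n} {X Y : Subset n} → X ⊆ Y → ¬ Y ⊆ X → size X < size Y
size-< {X = X} {Y} X⊆Y Y⊈X with ⊈⇒∃ {X = X} {Y} Y⊈X
... | p , p∈Y , p∉X = #-strict (In X) (In Y) (λ _ → X⊆Y) p p∈Y p∉X

size-≡ : ∀ {n} {X Y : Subset n} → X ⊆ Y → size X ≡ size Y → X ≡ Y
size-≡ {X = X} {Y} X⊆Y e = ⊆-antisym X⊆Y
  (decidable-stable (Y ⊆? X) (λ Y⊈X → <-irrefl e (size-< {X = X} {Y} X⊆Y Y⊈X)))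

-- Collinearity, perps, and joins of a point to a subspace

module Polar (G : Geometry) (n s t : ℕ) (3≤n : 3 ≤ n) (ps : IsPolarSpaceOfOrder G n s t) where
  open Geometry G
  open IsPolarSpaceOfOrder ps

  Pt Sb : Set
  Pt = Fin N
  Sb = Subset N

  infix 4 _⊥_ _⊥ˢ_
  _⊥_ : Pt → Pt → Set
  _⊥_ = Collinear G

  _⊥?_ : ∀ p q → Dec (p ⊥ q)
  p ⊥? q = (p ≟ q) ⊎-dec Finₚ.any? (λ ℓ → (p ∈? pts ℓ) ×-dec (q ∈? pts ℓ))

  ⊥-refl : ∀ {p} → p ⊥ p
  ⊥-refl = inj₁ refl

  ⊥-sym : ∀ {p q} → p ⊥ q → q ⊥ p
  ⊥-sym (inj₁ e)             = inj₁ (sym e)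
  ⊥-sym (inj₂ (ℓ , p∈ , q∈)) = inj₂ (ℓ , q∈ , p∈)

  lineThrough : ∀ {p q} → p ⊥ q → p ≢ q → ∃ λ ℓ → p ∈ pts ℓ × q ∈ pts ℓ
  lineThrough (inj₁ e)  p≢q = ⊥-elim (p≢q e)
  lineThrough (inj₂ ln) p≢q = ln

  ⊥-line : ∀ {ℓ a b p q} → a ≢ b → a ∈ pts ℓ → b ∈ pts ℓ → q ∈ pts ℓ → p ⊥ a → p ⊥ b → p ⊥ q
  ⊥-line {ℓ} {a} {b} {p} {q} a≢b a∈ b∈ q∈ pa pb with oneOrAll p ℓ
  ... | inj₁ all        = all q q∈
  ... | inj₂ (_ , uniq) = ⊥-elim (a≢b (uniq a b a∈ b∈ pa pb))

  foot : ∀ p {ℓ a} → a ∈ pts ℓ → ∃ λ q → q ∈ pts ℓ × p ⊥ q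
  foot p {ℓ} {a} a∈ with oneOrAll p ℓ
  ... | inj₁ all      = a , a∈ , all a a∈
  ... | inj₂ (ex , _) = ex

  foot-unique : ∀ {p ℓ a q r} → a ∈ pts ℓ → ¬ p ⊥ a → q ∈ pts ℓ → r ∈ pts ℓ → p ⊥ q → p ⊥ r → q ≡ r
  foot-unique {p} {ℓ} {a} {q} {r} a∈ ¬pa q∈ r∈ pq pr with oneOrAll p ℓ
  ... | inj₁ all        = ⊥-elim (¬pa (all a a∈))
  ... | inj₂ (_ , uniq) = uniq q r q∈ r∈ pq pr

  _⊥ˢ_ : Pt → Sb → Set
  p ⊥ˢ X = ∀ x → x ∈ X → p ⊥ x

  _⊥ˢ?_ : ∀ p X → Dec (p ⊥ˢ X)
  p ⊥ˢ? X = Finₚ.all? (λ x → (x ∈? X) →-dec (p ⊥? x))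

  ⊥ˢ-line : ∀ {ℓ a b q X} → a ≢ b → a ∈ pts ℓ → b ∈ pts ℓ → q ∈ pts ℓ → a ⊥ˢ X → b ⊥ˢ X → q ⊥ˢ X
  ⊥ˢ-line a≢b a∈ b∈ q∈ aX bX x x∈ = ⊥-sym (⊥-line a≢b a∈ b∈ q∈ (⊥-sym (aX x x∈)) (⊥-sym (bX x x∈)))

  ⊥ˢ-⊆ : ∀ {p X Y} → X ⊆ Y → p ⊥ˢ Y → p ⊥ˢ X
  ⊥ˢ-⊆ X⊆Y pY x x∈ = pY x (X⊆Y x∈)

  Singular? : ∀ X → Dec (Singular G X)
  Singular? X =
    Finₚ.all? (λ p → Finₚ.all? λ q → (p ∈? X) →-dec ((q ∈? X) →-dec (p ⊥? q)))
    ×-dec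
    Finₚ.all? (λ ℓ → Finₚ.all? λ p → Finₚ.all? λ q → ¬? (p ≟ q) →-dec
      ((p ∈? pts ℓ) →-dec ((q ∈? pts ℓ) →-dec ((p ∈? X) →-dec ((q ∈? X) →-dec (pts ℓ ⊆? X))))))

  singular⇒⊥ˢ : ∀ {X p} → Singular G X → p ∈ X → p ⊥ˢ X
  singular⇒⊥ˢ (c , _) p∈ x x∈ = c _ x p∈ x∈

  ∅-singular : Singular G ∅
  ∅-singular = (λ _ _ p∈ → ⊥-elim (∉⊥ p∈)) , (λ _ _ _ _ _ _ p∈ → ⊥-elim (∉⊥ p∈))

  ∩-singular : ∀ {X Y} → Singular G X → Singular G Y → Singular G (X ∩ Y)
  ∩-singular {X} {Y} (c , l) (_ , l') =
    (λ p q p∈ q∈ → c p q (p∩q⊆p X Y p∈) (p∩q⊆p X Y q∈)) ,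
    (λ ℓ p q p≢q p∈ℓ q∈ℓ p∈ q∈ r∈ → x∈p∩q⁺
      ( l ℓ p q p≢q p∈ℓ q∈ℓ (p∩q⊆p X Y p∈) (p∩q⊆p X Y q∈) r∈
      , l' ℓ p q p≢q p∈ℓ q∈ℓ (p∩q⊆q X Y p∈) (p∩q⊆q X Y q∈) r∈))

  -- The inclusion of X^⊥⊥ in X; the reverse inclusion holds for every set of points.
  Closed : Sb → Set
  Closed X = ∀ q → (∀ z → z ⊥ˢ X → z ⊥ q) → q ∈ X

  separate : ∀ {X q} → Closed X → ¬ q ∈ X → ∃ λ z → z ⊥ˢ X × ¬ z ⊥ q
  separate {X} {q} cl q∉ with Finₚ.any? (λ z → (z ⊥ˢ? X) ×-dec ¬? (z ⊥? q))
  ... | yes e = e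
  ... | no ¬e = ⊥-elim (q∉ (cl q (λ z zX → decidable-stable (z ⊥? q) (λ ¬zq → ¬e (z , zX , ¬zq)))))

  -- Meant for p outside X, since x = p would admit every line through p. The alternative q = p is
  -- there for empty X, whose join with p is the single point p.
  OnJoin : Sb → Pt → Pt → Set
  OnJoin X p q = q ≡ p ⊎ ∃ λ x → x ∈ X × ∃ λ ℓ → p ∈ pts ℓ × x ∈ pts ℓ × q ∈ pts ℓ

  onJoin? : ∀ X p q → Dec (OnJoin X p q)
  onJoin? X p q = (q ≟ p) ⊎-dec Finₚ.any? (λ x → (x ∈? X) ×-dec
    Finₚ.any? (λ ℓ → (p ∈? pts ℓ) ×-dec ((x ∈? pts ℓ) ×-dec (q ∈? pts ℓ))))

  joinPred : Sb → Pt → DecPred Pt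
  joinPred X p = OnJoin X p by onJoin? X p

  J : Sb → Pt → Sb
  J X p = ⟪ joinPred X p ⟫

  -- The line through z and u lies in X^⊥ and contains a point v collinear with p, hence with q,
  -- hence with r. It differs from z because z is not collinear with q, so r is collinear with v and
  -- z and therefore with u.
  perp-transfer : ∀ {X ℓ p q z r} → p ≢ q → p ∈ pts ℓ → q ∈ pts ℓ → r ∈ pts ℓ →
    (∀ u → u ⊥ˢ X → u ⊥ p → u ⊥ q) → z ⊥ˢ X → ¬ z ⊥ q → z ⊥ r →
    ∀ u → u ⊥ˢ X → u ⊥ z → u ⊥ r
  perp-transfer {z = z} p≢q p∈ q∈ r∈ p⇒q zX ¬zq zr u uX uz with u ≟ z
  ... | yes refl = zr
  ... | no u≢z with lineThrough uz u≢z
  ... | m , u∈m , z∈m with foot _ u∈m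
  ... | v , v∈m , pv = ⊥-sym (⊥-line v≢z v∈m z∈m u∈m (⊥-sym vr) (⊥-sym zr))
    where
    vX = ⊥ˢ-line u≢z u∈m z∈m v∈m uX zX
    vq = p⇒q v vX (⊥-sym pv)
    vr = ⊥-line p≢q p∈ q∈ r∈ (⊥-sym pv) vq
    v≢z : v ≢ z
    v≢z refl = ¬zq vq

  -- This is where the Veblen–Young axiom for singular subspaces comes from: the union of the lines
  -- joining p to X is the biperp of X ∪ {p}, and a biperp is a subspace.
  biperp⇒onJoin : ∀ {X p q} → Singular G X → Closed X → p ⊥ˢ X → ¬ p ∈ X →
    (∀ z → z ⊥ˢ X → z ⊥ p → z ⊥ q) → OnJoin X p q
  biperp⇒onJoin {X} {p} {q} sg cl pX p∉ p⇒q with q ≟ p | q ∈? X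
  ... | yes e  | _ = inj₁ e
  ... | no q≢p | yes q∈ with lineThrough (p⇒q p pX ⊥-refl) (q≢p ∘ sym)
  ...   | ℓ , p∈ℓ , q∈ℓ = inj₂ (q , q∈ , ℓ , p∈ℓ , q∈ℓ , q∈ℓ)
  biperp⇒onJoin {X} {p} {q} sg cl pX p∉ p⇒q | no q≢p | no q∉
    with lineThrough (p⇒q p pX ⊥-refl) (q≢p ∘ sym) | separate cl q∉
  ... | ℓ , p∈ℓ , q∈ℓ | z , zX , ¬zq with foot z p∈ℓ
  ... | r , r∈ℓ , zr with r ∈? X
  ... | yes r∈ = inj₂ (r , r∈ , ℓ , p∈ℓ , r∈ℓ , q∈ℓ)
  -- The remaining case is contradictory. Let w separate r from X, with feet x on the line zr and y
  -- on ℓ. By `perp-transfer` x ⊥ y, so y is collinear with x and r, hence with z; but r is the only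
  -- point of ℓ collinear with z, so y = r, although w is not collinear with r.
  ... | no r∉ with separate cl r∉ | lineThrough {z} {r} zr (λ { refl → ¬zq (inj₂ (ℓ , r∈ℓ , q∈ℓ)) })
  ... | w , wX , ¬wr | m , z∈m , r∈m with foot w z∈m | foot w p∈ℓ
  ... | x , x∈m , wx | y , y∈ℓ , wy = ⊥-elim (¬wr (subst (w ⊥_) y≡r wy))
    where
    qX : q ⊥ˢ X
    qX a a∈ = ⊥-sym (p⇒q a (singular⇒⊥ˢ sg a∈) (⊥-sym (pX a a∈)))
    rX : r ⊥ˢ X
    rX = ⊥ˢ-line (q≢p ∘ sym) p∈ℓ q∈ℓ r∈ℓ pX qX
    z≢r : z ≢ r
    z≢r refl = ¬zq (inj₂ (ℓ , r∈ℓ , q∈ℓ))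
    p≢r : p ≢ r
    p≢r refl = ¬zq (p⇒q z zX zr)
    xX : x ⊥ˢ X
    xX = ⊥ˢ-line z≢r z∈m r∈m x∈m zX rX
    p⇒r : ∀ u → u ⊥ˢ X → u ⊥ p → u ⊥ r
    p⇒r u uX up = ⊥-line (q≢p ∘ sym) p∈ℓ q∈ℓ r∈ℓ up (p⇒q u uX up)
    w⇒y : ∀ u → u ⊥ˢ X → u ⊥ w → u ⊥ y
    w⇒y = perp-transfer p≢r p∈ℓ r∈ℓ y∈ℓ p⇒r wX ¬wr wy
    xy : x ⊥ y
    xy = w⇒y x xX (⊥-sym wx)
    x≢r : x ≢ r
    x≢r refl = ¬wr wx
    yz : y ⊥ z
    yz = ⊥-line x≢r x∈m r∈m z∈m (⊥-sym xy) (inj₂ (ℓ , y∈ℓ , r∈ℓ))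
    y≡r : y ≡ r
    y≡r = foot-unique q∈ℓ ¬zq y∈ℓ r∈ℓ (⊥-sym yz) zr

  onJoin⇒biperp : ∀ {X p q} → ¬ p ∈ X → OnJoin X p q → ∀ z → z ⊥ˢ X → z ⊥ p → z ⊥ q
  onJoin⇒biperp p∉ (inj₁ refl) z zX zp = zp
  onJoin⇒biperp p∉ (inj₂ (x , x∈ , ℓ , p∈ℓ , x∈ℓ , q∈ℓ)) z zX zp =
    ⊥-line (λ { refl → p∉ x∈ }) p∈ℓ x∈ℓ q∈ℓ zp (zX x x∈)

  ∈J⁺ : ∀ {X p q} → OnJoin X p q → q ∈ J X p
  ∈J⁺ {X} {p} = ∈⟪⟫⁺ (joinPred X p)
  ∈J⁻ : ∀ {X p q} → q ∈ J X p → OnJoin X p q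
  ∈J⁻ {X} {p} = ∈⟪⟫⁻ (joinPred X p)

  p∈J : ∀ {X p} → p ∈ J X p
  p∈J = ∈J⁺ (inj₁ refl)

  X⊆J : ∀ {X p} → p ⊥ˢ X → X ⊆ J X p
  X⊆J {X} {p} pX {x} x∈ with x ≟ p
  ... | yes e  = ∈J⁺ (inj₁ e)
  ... | no x≢p with lineThrough (pX x x∈) (x≢p ∘ sym)
  ...   | ℓ , p∈ℓ , x∈ℓ = ∈J⁺ (inj₂ (x , x∈ , ℓ , p∈ℓ , x∈ℓ , x∈ℓ))

  J⊆ : ∀ {X p W} → Singular G W → ¬ p ∈ X → X ⊆ W → p ∈ W → J X p ⊆ W
  J⊆ sg p∉ X⊆W p∈W q∈ with ∈J⁻ q∈
  ... | inj₁ refl = p∈W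
  ... | inj₂ (x , x∈ , ℓ , p∈ℓ , x∈ℓ , q∈ℓ) =
    proj₂ sg ℓ _ x (λ { refl → p∉ x∈ }) p∈ℓ x∈ℓ p∈W (X⊆W x∈) q∈ℓ

  ⊥ˢ-J : ∀ {X p z} → ¬ p ∈ X → z ⊥ˢ X → z ⊥ p → z ⊥ˢ J X p
  ⊥ˢ-J p∉ zX zp q q∈ = onJoin⇒biperp p∉ (∈J⁻ q∈) _ zX zp

  module _ {X p} (sg : Singular G X) (cl : Closed X) (pX : p ⊥ˢ X) (p∉ : ¬ p ∈ X) where
    private
      J⇒⊥ˢ : ∀ {q} → q ∈ J X p → q ⊥ˢ J X p
      J⇒⊥ˢ {q} q∈ = ⊥ˢ-J p∉ (λ x x∈ → ⊥-sym (⊥ˢ-J p∉ (singular⇒⊥ˢ sg x∈) (⊥-sym (pX x x∈)) q q∈))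
                            (⊥-sym (⊥ˢ-J p∉ pX ⊥-refl q q∈))

    -- A point on a line through two points of the join is collinear with everything in X^⊥ that is
    -- collinear with p, so `biperp⇒onJoin` puts it on the join. Closedness of X, assumed here, is
    -- supplied for all singular subspaces by `singular-closed-ranked`.
    J-singular′ : Singular G (J X p)
    J-singular′ = (λ a b a∈ b∈ → J⇒⊥ˢ a∈ b b∈) ,
      (λ ℓ a b a≢b a∈ℓ b∈ℓ a∈ b∈ {c} c∈ℓ → ∈J⁺ (biperp⇒onJoin sg cl pX p∉ (λ z zX zp →
        ⊥-line a≢b a∈ℓ b∈ℓ c∈ℓ (⊥ˢ-J p∉ zX zp a a∈) (⊥ˢ-J p∉ zX zp b b∈))))

    J-closed′ : Closed (J X p)
    J-closed′ q h = ∈J⁺ (biperp⇒onJoin sg cl pX p∉ (λ z zX zp → h z (⊥ˢ-J p∉ zX zp)))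

  -- Numbers of points and ranks of singular subspaces

  size-line : ∀ ℓ → size (pts ℓ) ≡ suc s
  size-line ℓ = trans (sym (∣∣≡size (pts ℓ))) (lineSize ℓ)

  #-line∖point : ∀ {ℓ p} → p ∈ pts ℓ → # (In (pts ℓ) ∧ ∁ (is p)) ≡ s
  #-line∖point {ℓ} {p} p∈ℓ = suc-injective (begin
    1 + # (In (pts ℓ) ∧ ∁ (is p))        ≡⟨ cong (_+ # (In (pts ℓ) ∧ ∁ (is p))) (sym (#-is p)) ⟩
    # (is p) + # (In (pts ℓ) ∧ ∁ (is p)) ≡⟨ sym (#-relative (In (pts ℓ)) (is p) (λ { _ refl → p∈ℓ })) ⟩
    size (pts ℓ)                         ≡⟨ size-line ℓ ⟩
    suc s ∎)
    where open ≡-Reasoning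

  OnLine : Pt → Pt → DecPred Pt
  OnLine p z = (λ x → ∃ λ ℓ → p ∈ pts ℓ × x ∈ pts ℓ × z ∈ pts ℓ) by
    (λ x → Finₚ.any? (λ ℓ → (p ∈? pts ℓ) ×-dec ((x ∈? pts ℓ) ×-dec (z ∈? pts ℓ))))

  -- Projection from p: each point of the join other than p lies on the line from p to exactly one x
  -- in X, as two would put p into X, and each such line has s points besides p.
  J-size : ∀ {X p} → Singular G X → p ⊥ˢ X → ¬ p ∈ X → size (J X p) ≡ suc (s * size X)
  J-size {X} {p} sg pX p∉ = begin
    size (J X p)                         ≡⟨ #-relative (In (J X p)) (is p) (λ { _ refl → p∈J }) ⟩
    # (is p) + # (In (J X p) ∧ ∁ (is p)) ≡⟨ cong₂ _+_ (#-is p) offVertex ⟩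
    suc (s * size X)                     ∎
    where
    open ≡-Reasoning
    row : ∀ z → Holds (In (J X p) ∧ ∁ (is p)) z → # (In X ∧ OnLine p z) * 1 ≡ 1
    row z (z∈ , z≢p) with ∈J⁻ z∈
    ... | inj₁ e = ⊥-elim (z≢p e)
    ... | inj₂ (x , x∈ , ℓ , p∈ℓ , x∈ℓ , z∈ℓ) = trans (*-identityʳ _)
      (#-unique (In X ∧ OnLine p z) x (x∈ , ℓ , p∈ℓ , x∈ℓ , z∈ℓ) uniq)
      where
      uniq : ∀ x' → Holds (In X ∧ OnLine p z) x' → x' ≡ x
      uniq x' (x'∈ , ℓ' , p∈ℓ' , x'∈ℓ' , z∈ℓ') with partialLinear ℓ' ℓ p z (z≢p ∘ sym) p∈ℓ' z∈ℓ' p∈ℓ z∈ℓ | x' ≟ x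
      ... | refl | yes e = e
      ... | refl | no ne = ⊥-elim (p∉ (proj₂ sg ℓ x' x ne x'∈ℓ' x∈ℓ x'∈ x∈ p∈ℓ))
    col : ∀ x → Holds (In X) x →
      # ((In (J X p) ∧ ∁ (is p)) ∧ ((λ z → Holds (OnLine p z) x) by (λ z → dec (OnLine p z) x))) ≡ s
    col x x∈ with lineThrough (pX x x∈) (λ { refl → p∉ x∈ })
    ... | ℓ , p∈ℓ , x∈ℓ = trans (#-cong _ (In (pts ℓ) ∧ ∁ (is p)) to
        (λ z z∈ → (∈J⁺ (inj₂ (x , x∈ , ℓ , p∈ℓ , x∈ℓ , proj₁ z∈)) , proj₂ z∈) , ℓ , p∈ℓ , x∈ℓ , proj₁ z∈))
        (#-line∖point p∈ℓ)
      where
      to : ∀ z → (z ∈ J X p × z ≢ p) × Holds (OnLine p z) x → z ∈ pts ℓ × z ≢ p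
      to z ((z∈ , z≢p) , ℓ' , p∈ℓ' , x∈ℓ' , z∈ℓ')
        with partialLinear ℓ' ℓ p x (λ { refl → p∉ x∈ }) p∈ℓ' x∈ℓ' p∈ℓ x∈ℓ
      ... | refl = z∈ℓ' , z≢p
    offVertex : # (In (J X p) ∧ ∁ (is p)) ≡ s * size X
    offVertex = begin
      # (In (J X p) ∧ ∁ (is p))     ≡⟨ sym (*-identityʳ _) ⟩
      # (In (J X p) ∧ ∁ (is p)) * 1 ≡⟨ double-count (In (J X p) ∧ ∁ (is p)) (In X) (OnLine p) 1 1 s row col ⟩
      size X * s * 1                ≡⟨ *-identityʳ _ ⟩
      size X * s                    ≡⟨ *-comm (size X) s ⟩
      s * size X ∎

  -- The number [r] of points of a projective space of vector dimension r and order s.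
  br : ℕ → ℕ
  br zero    = 0
  br (suc r) = suc (s * br r)

  ∅-closed : Closed ∅
  ∅-closed q h with nondegenerate q
  ... | z , ¬qz = ⊥-elim (¬qz (⊥-sym (h z (λ _ x∈ → ⊥-elim (∉⊥ x∈)))))

  size-∅ : size {N} ∅ ≡ 0
  size-∅ = #-empty (In {N} ∅) (λ _ → ∉⊥)

  private
    -- X is exhausted from inside: starting at the empty set, which is closed by nondegeneracy,
    -- joining points of X preserves closedness and the size formula. `fuel` bounds the number of
    -- points of X still missing.
    grow : ∀ {X} → Singular G X → ∀ fuel {Y} r → Y ⊆ X → Singular G Y → Closed Y → size Y ≡ br r →
      size X ≤ size Y + fuel → Closed X × ∃ λ r → size X ≡ br r
    grow {X} sX fuel {Y} r Y⊆X sY cY eY bound with X ⊆? Y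
    ... | yes X⊆Y with ⊆-antisym Y⊆X X⊆Y
    ...   | refl = cY , r , eY
    grow {X} sX fuel {Y} r Y⊆X sY cY eY bound | no X⊈Y with ⊈⇒∃ {X = Y} {X} X⊈Y
    ... | p , p∈X , p∉Y = next fuel bound
      where
      pY = ⊥ˢ-⊆ Y⊆X (singular⇒⊥ˢ sX p∈X)
      next : ∀ fuel → size X ≤ size Y + fuel → Closed X × ∃ λ r → size X ≡ br r
      next zero    b = ⊥-elim (<-irrefl refl (<-≤-trans (size-< {X = Y} {X} Y⊆X X⊈Y)
        (subst (size X ≤_) (+-identityʳ _) b)))
      next (suc f) b = grow sX f (suc r) (J⊆ sX p∉Y Y⊆X p∈X) (J-singular′ sY cY pY p∉Y) (J-closed′ sY cY pY p∉Y)
        (trans (J-size sY pY p∉Y) (cong (λ z → suc (s * z)) eY))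
        (≤-trans b (subst (_≤ size (J Y p) + f) (sym (+-suc (size Y) f))
          (+-monoˡ-≤ f (#-strict (In Y) (In (J Y p)) (λ _ → X⊆J pY) p p∈J p∉Y))))

  singular-closed-ranked : ∀ {X} → Singular G X → Closed X × ∃ λ r → size X ≡ br r
  singular-closed-ranked {X} sX = grow sX (size X) 0 (λ x∈ → ⊥-elim (∉⊥ x∈)) ∅-singular ∅-closed size-∅
    (m≤n+m (size X) (size {N} ∅))

  J-singular : ∀ {X p} → Singular G X → p ⊥ˢ X → ¬ p ∈ X → Singular G (J X p)
  J-singular sX = J-singular′ sX (proj₁ (singular-closed-ranked sX))

  instance
    s-nonZero : NonZero s
    s-nonZero = >-nonZero (<-trans (s≤s z≤n) s>1)

  br-< : ∀ {a b} → a < b → br a < br b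
  br-< {zero}  {suc b} _         = s≤s z≤n
  br-< {suc a} {suc b} (s≤s a<b) = s≤s (*-monoʳ-< s (br-< a<b))

  br-injective : ∀ {a b} → br a ≡ br b → a ≡ b
  br-injective {zero}  {zero}  e = refl
  br-injective {suc a} {suc b} e = cong suc (br-injective (*-cancelˡ-≡ _ _ s (suc-injective e)))

  br-≤⁻ : ∀ {a b} → br a ≤ br b → a ≤ b
  br-≤⁻ le = ≮⇒≥ (λ b<a → <⇒≱ (br-< b<a) le)

  br-+ : ∀ a b → br (a + b) ≡ br a + s ^ a * br b
  br-+ zero    b = sym (+-identityʳ _)
  br-+ (suc a) b = cong suc (begin
    s * br (a + b)              ≡⟨ cong (s *_) (br-+ a b) ⟩
    s * (br a + s ^ a * br b)   ≡⟨ *-distribˡ-+ s (br a) _ ⟩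
    s * br a + s * (s ^ a * br b) ≡⟨ cong (s * br a +_) (sym (*-assoc s (s ^ a) (br b))) ⟩
    s * br a + s * s ^ a * br b ∎)
    where open ≡-Reasoning

  -- Ranks are vector space dimensions: Rk (suc u) is the paper's Δ_u.
  record Rk (r : ℕ) (X : Sb) : Set where
    constructor rk
    field
      singular : Singular G X
      rank-size : size X ≡ br r
  open Rk public

  Rank : ℕ → DecPred Sb
  Rank r = Rk r by (λ X → map′ (λ { (sX , e) → rk sX e }) (λ { (rk sX e) → sX , e })
    (Singular? X ×-dec (size X ℕ.≟ br r)))

  rankOf : ∀ {X} → Singular G X → ∃ λ r → Rk r X
  rankOf sX with singular-closed-ranked sX
  ... | _ , r , e = r , rk sX e

  ∅-rank : Rk 0 ∅
  ∅-rank = rk ∅-singular size-∅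

  rank-unique : ∀ {a b X} → Rk a X → Rk b X → a ≡ b
  rank-unique (rk _ e) (rk _ e') = br-injective (trans (sym e) e')

  rank-⊆ : ∀ {a b X Y} → X ⊆ Y → Rk a X → Rk b Y → a ≤ b
  rank-⊆ {X = X} {Y} X⊆Y (rk _ e) (rk _ e') = br-≤⁻ (subst₂ _≤_ e e' (size-⊆ {X = X} {Y} X⊆Y))

  rank-≡ : ∀ {a X Y} → X ⊆ Y → Rk a X → Rk a Y → X ≡ Y
  rank-≡ X⊆Y (rk _ e) (rk _ e') = size-≡ X⊆Y (trans e (sym e'))

  rank-0 : ∀ {X} → Rk 0 X → X ≡ ∅
  rank-0 rX = sym (rank-≡ (λ x∈ → ⊥-elim (∉⊥ x∈)) ∅-rank rX)

  J-rank : ∀ {r X p} → Rk r X → p ⊥ˢ X → ¬ p ∈ X → Rk (suc r) (J X p)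
  J-rank (rk sX e) pX p∉ = rk (J-singular sX pX p∉) (trans (J-size sX pX p∉) (cong (λ z → suc (s * z)) e))

  pointOutside : ∀ {a b X Y} → Rk a X → Rk b Y → a < b → ∃ λ p → p ∈ Y × ¬ p ∈ X
  pointOutside {a} {b} {X} {Y} rX rY a<b = ⊈⇒∃ {X = X} {Y} (λ Y⊆X → <⇒≱ a<b (rank-⊆ Y⊆X rY rX))

  rank-sub : ∀ {r X} → Rk r X → ∀ z → z ≤ r → ∃ λ Y → Y ⊆ X × Rk z Y
  rank-sub rX zero    _   = ∅ , (λ x∈ → ⊥-elim (∉⊥ x∈)) , ∅-rank
  rank-sub rX (suc z) z<r =
    let Y , Y⊆X , rY  = rank-sub rX z (<⇒≤ z<r)
        p , p∈X , p∉Y = pointOutside rY rX z<r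
    in J Y p , J⊆ (singular rX) p∉Y Y⊆X p∈X , J-rank rY (⊥ˢ-⊆ Y⊆X (singular⇒⊥ˢ (singular rX) p∈X)) p∉Y

  infixl 6 _∖_
  _∖_ : Sb → Sb → DecPred Pt
  Y ∖ X = In Y ∧ ∁ (In X)

  #-∖ : ∀ {z d X Y} → X ⊆ Y → Rk z X → Rk (z + d) Y → # (Y ∖ X) ≡ s ^ z * br d
  #-∖ {z} {d} {X} {Y} X⊆Y (rk _ e) (rk _ e') = +-cancelˡ-≡ (br z) _ _ (begin
    br z + # (Y ∖ X)   ≡⟨ cong (_+ # (Y ∖ X)) (sym e) ⟩
    size X + # (Y ∖ X) ≡⟨ sym (#-relative (In Y) (In X) (λ _ → X⊆Y)) ⟩
    size Y             ≡⟨ e' ⟩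
    br (z + d)         ≡⟨ br-+ z d ⟩
    br z + s ^ z * br d ∎)
    where open ≡-Reasoning

  -- Chains, dimension and maximal singular subspaces

  chain-singular : ∀ {X} d → Chain G X d → Singular G X
  chain-singular zero    (sX , _) = sX
  chain-singular (suc d) (sX , _) = sX

  chain⇒rank> : ∀ {X r} d → Chain G X d → Rk r X → d < r
  chain⇒rank> {X} {zero} zero (sX , x , x∈) rX = ⊥-elim (∉⊥ (subst (x ∈_) (rank-0 rX) x∈))
  chain⇒rank> {X} {suc r} zero _ rX = s≤s z≤n
  chain⇒rank> {X} {r} (suc d) (sX , Y , (Y⊆X , x , x∈X , x∉Y) , ch) rX with rankOf (chain-singular d ch)
  ... | r' , rY = <-≤-trans (s≤s (chain⇒rank> d ch rY)) (≤∧≢⇒< (rank-⊆ Y⊆X rY rX) λ { refl →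
        x∉Y (subst (x ∈_) (sym (rank-≡ Y⊆X rY rX)) x∈X) })

  rank>⇒chain : ∀ {X r} d → Rk r X → d < r → Chain G X d
  rank>⇒chain zero rX 0<r =
    let p , p∈ , _ = pointOutside ∅-rank rX 0<r in singular rX , p , p∈
  rank>⇒chain (suc d) rX d<r =
    let Y , Y⊆X , rY = rank-sub rX (suc d) (<⇒≤ d<r)
        p , p∈ , p∉  = pointOutside rY rX d<r
    in singular rX , Y , ((λ {x} → Y⊆X {x}) , p , p∈ , p∉) , rank>⇒chain d rY ≤-refl

  dim⇒rank : ∀ {X d} → Dim G X d → Rk (suc d) X
  dim⇒rank {X} {d} (ch , ¬ch) with rankOf (chain-singular d ch)
  ... | r , rX = subst (λ k → Rk k X)
    (≤-antisym (≮⇒≥ (λ d<r → ¬ch (rank>⇒chain (suc d) rX d<r))) (chain⇒rank> d ch rX)) rX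

  rank⇒dim : ∀ {X d} → Rk (suc d) X → Dim G X d
  rank⇒dim {X} {d} rX = rank>⇒chain d rX ≤-refl , λ ch → <-irrefl refl (chain⇒rank> (suc d) ch rX)

  Δ⇒rank : ∀ {u X} → Δ G u X → Rk (suc u) X
  Δ⇒rank (_ , dim) = dim⇒rank dim

  rank⇒Δ : ∀ {u X} → Rk (suc u) X → Δ G u X
  rank⇒Δ rX = singular rX , rank⇒dim rX

  rank≤n : ∀ {r X} → Rk r X → r ≤ n
  rank≤n rX = ≮⇒≥ (λ n<r → rank-max _ (rank>⇒chain n rX n<r))

  1+n∸1 : suc (n ∸ 1) ≡ n
  1+n∸1 = m+[n∸m]≡n (≤-trans (s≤s z≤n) 3≤n)

  maximal : ∀ {M p} → Rk n M → p ⊥ˢ M → p ∈ M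
  maximal {M} {p} rM pM = decidable-stable (p ∈? M) (λ p∉ → <-irrefl refl (rank≤n (J-rank rM pM p∉)))

  someMaximal : ∃ λ M → Rk n M
  someMaximal with rank-ex
  ... | M , ΔM = M , subst (λ k → Rk k M) 1+n∸1 (Δ⇒rank ΔM)

  module _ {M p} (rM : Rk n M) (p∉M : ¬ p ∈ M) where
    private
      H : Sb
      H = ⟪ In M ∧ ((p ⊥_) by (p ⊥?_)) ⟫
      ∈H⁺ : ∀ {x} → x ∈ M → p ⊥ x → x ∈ H
      ∈H⁺ x∈ px = ∈⟪⟫⁺ (In M ∧ ((p ⊥_) by (p ⊥?_))) (x∈ , px)
      ∈H⁻ : ∀ {x} → x ∈ H → x ∈ M × p ⊥ x
      ∈H⁻ = ∈⟪⟫⁻ (In M ∧ ((p ⊥_) by (p ⊥?_)))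
      sH : Singular G H
      sH = (λ a b a∈ b∈ → proj₁ (singular rM) a b (proj₁ (∈H⁻ a∈)) (proj₁ (∈H⁻ b∈))) ,
        (λ ℓ a b a≢b a∈ℓ b∈ℓ a∈ b∈ c∈ℓ → ∈H⁺
          (proj₂ (singular rM) ℓ a b a≢b a∈ℓ b∈ℓ (proj₁ (∈H⁻ a∈)) (proj₁ (∈H⁻ b∈)) c∈ℓ)
          (⊥-line a≢b a∈ℓ b∈ℓ c∈ℓ (proj₂ (∈H⁻ a∈)) (proj₂ (∈H⁻ b∈))))
      m-exists : ∃ λ m → m ∈ M × ¬ p ⊥ m
      m-exists with Finₚ.any? (λ m → (m ∈? M) ×-dec ¬? (p ⊥? m))
      ... | yes e = e
      ... | no ¬e = ⊥-elim (p∉M (maximal rM (λ m m∈ → decidable-stable (p ⊥? m) (λ ¬pm → ¬e (m , m∈ , ¬pm)))))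
      m = proj₁ m-exists
      m∈M = proj₁ (proj₂ m-exists)
      ¬pm = proj₂ (proj₂ m-exists)
      m∉H : ¬ m ∈ H
      m∉H m∈ = ¬pm (proj₂ (∈H⁻ m∈))
      M⊆J : M ⊆ J H m
      M⊆J {a} a∈M with a ≟ m
      ... | yes e  = ∈J⁺ (inj₁ e)
      ... | no a≢m with lineThrough (proj₁ (singular rM) a m a∈M m∈M) a≢m
      ... | ℓ , a∈ℓ , m∈ℓ with foot p m∈ℓ
      ... | x , x∈ℓ , px = ∈J⁺ (inj₂ (x , ∈H⁺ (proj₂ (singular rM) ℓ a m a≢m a∈ℓ m∈ℓ a∈M m∈M x∈ℓ) px ,
                                  ℓ , m∈ℓ , x∈ℓ , a∈ℓ))
      H⊆M : H ⊆ M
      H⊆M x∈ = proj₁ (∈H⁻ x∈)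
      J≡M : J H m ≡ M
      J≡M = ⊆-antisym (J⊆ (singular rM) m∉H H⊆M m∈M) M⊆J
      rH : Rk (n ∸ 1) H
      rH with rankOf sH
      ... | h , rH = subst (λ k → Rk k H) (cong (_∸ 1) (rank-unique
              (subst (Rk (suc h)) J≡M (J-rank rH (⊥ˢ-⊆ H⊆M (singular⇒⊥ˢ (singular rM) m∈M)) m∉H)) rM)) rH
      p⊥H : p ⊥ˢ H
      p⊥H x x∈ = proj₂ (∈H⁻ x∈)

    -- The points of M collinear with p form a hyperplane H: some m in M is not collinear with p,
    -- and every line of M through m meets H, so M is the join of m and H. Joining p to H instead
    -- gives rank n again.
    project : ∃ λ M' → Rk n M' × p ∈ M' × (∀ x → x ∈ M → p ⊥ x → x ∈ M')
    project = J H p , subst (λ k → Rk k (J H p)) 1+n∸1 (J-rank rH p⊥H (λ p∈ → p∉M (H⊆M p∈))) ,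
      p∈J , λ x x∈ px → X⊆J p⊥H (∈H⁺ x∈ px)

  -- Projecting M from a point p of W ∖ M yields a maximal subspace through p and W ∩ M.
  enlarge : ∀ {W M} → Singular G W → Rk n M → ¬ W ⊆ M → ∃ λ M' → Rk n M' × size (W ∩ M) < size (W ∩ M')
  enlarge {W} {M} sW rM W⊈M =
    let p , p∈W , p∉M = ⊈⇒∃ {X = M} {W} W⊈M
        M' , rM' , p∈M' , keep = project rM p∉M
    in M' , rM' , #-strict (In (W ∩ M)) (In (W ∩ M'))
      (λ x x∈ → x∈p∩q⁺ (p∩q⊆p W M x∈ , keep x (p∩q⊆q W M x∈) (singular⇒⊥ˢ sW p∈W x (p∩q⊆p W M x∈))))
      p (x∈p∩q⁺ (p∈W , p∈M')) (λ p∈ → p∉M (p∩q⊆q W M p∈))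

  extendFrom : ∀ {W} → Singular G W → ∀ fuel {M} → Rk n M → size W ≤ size (W ∩ M) + fuel →
    ∃ λ M → Rk n M × W ⊆ M
  extendFrom {W} sW fuel {M} rM bound with W ⊆? M
  extendFrom {W} sW fuel {M} rM bound | yes W⊆M = M , rM , λ {x} → W⊆M {x}
  extendFrom {W} sW zero {M} rM bound | no W⊈M =
    let M' , rM' , lt = enlarge sW rM W⊈M
    in ⊥-elim (<-irrefl refl (<-≤-trans lt (≤-trans (size-⊆ {X = W ∩ M'} {W} (p∩q⊆p W M'))
         (subst (size W ≤_) (+-identityʳ _) bound))))
  extendFrom {W} sW (suc f) {M} rM bound | no W⊈M =
    let M' , rM' , lt = enlarge sW rM W⊈M
    in extendFrom sW f rM' (≤-trans bound
         (subst (_≤ size (W ∩ M') + f) (sym (+-suc (size (W ∩ M)) f)) (+-monoˡ-≤ f lt)))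

  -- Together with `maximal`, this makes the inclusion-maximal singular subspaces exactly those of
  -- rank n.
  extendToMaximal : ∀ {W} → Singular G W → ∃ λ M → Rk n M × W ⊆ M
  extendToMaximal {W} sW = extendFrom sW (size W) (proj₂ someMaximal) (m≤n+m (size W) _)

  extendable : ∀ {w W} → Rk w W → w < n → ∃ λ p → p ⊥ˢ W × ¬ p ∈ W
  extendable rW w<n =
    let M , rM , W⊆M  = extendToMaximal (singular rW)
        p , p∈M , p∉W = pointOutside rW rM w<n
    in p , ⊥ˢ-⊆ W⊆M (singular⇒⊥ˢ (singular rM) p∈M) , p∉W

  t>0 : 0 < t
  t>0 = n≢0⇒n>0 (λ { refl → absurd t-values })
    where
    absurd : ¬ (0 ≡ 1 ⊎ 0 ≡ s ⊎ 0 ≡ s ⊎ 0 ≡ s * s * s ⊎ 0 ≡ s * s)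
    absurd (inj₂ (inj₁ refl))        = case s>1 of λ ()
    absurd (inj₂ (inj₂ (inj₁ refl))) = case s>1 of λ ()
    absurd (inj₂ (inj₂ (inj₂ (inj₁ e)))) = ≢-nonZero⁻¹ (s * s * s) {{m*n≢0 (s * s) s {{m*n≢0 s s}}}} (sym e)
    absurd (inj₂ (inj₂ (inj₂ (inj₂ e)))) = ≢-nonZero⁻¹ (s * s) {{m*n≢0 s s}} (sym e)

  -- Points in the perp of a singular subspace

  infix 8 _^⊥
  _^⊥ : Sb → DecPred Pt
  X ^⊥ = (_⊥ˢ X) by (_⊥ˢ? X)

  -- Cuts W^⊥ along W ⊆ P ⊆ P^⊥ ⊆ W^⊥. Read forwards it gives the recursion for `Q`, read backwards
  -- the base case of the count of W^⊥ outside P^⊥.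
  flag-decomposition : ∀ {W P} → Singular G P → W ⊆ P →
    # (W ^⊥ ∧ ∁ (In W)) ≡ (# (P ∖ W) + # (P ^⊥ ∧ ∁ (In P))) + # (W ^⊥ ∧ ∁ (P ^⊥))
  flag-decomposition {W} {P} sP W⊆P = begin
    # (W ^⊥ ∧ ∁ (In W))
      ≡⟨ #-split (W ^⊥ ∧ ∁ (In W)) (P ^⊥) ⟩
    # ((W ^⊥ ∧ ∁ (In W)) ∧ P ^⊥) + # ((W ^⊥ ∧ ∁ (In W)) ∧ ∁ (P ^⊥))
      ≡⟨ cong₂ _+_ (#-split ((W ^⊥ ∧ ∁ (In W)) ∧ P ^⊥) (In P))
           (#-cong _ (W ^⊥ ∧ ∁ (P ^⊥)) (λ { a ((wa , _) , ¬pa) → wa , ¬pa })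
             (λ { a (wa , ¬pa) → (wa , λ a∈ → ¬pa (singular⇒⊥ˢ sP (W⊆P a∈))) , ¬pa })) ⟩
    # (((W ^⊥ ∧ ∁ (In W)) ∧ P ^⊥) ∧ In P) + # (((W ^⊥ ∧ ∁ (In W)) ∧ P ^⊥) ∧ ∁ (In P)) + # (W ^⊥ ∧ ∁ (P ^⊥))
      ≡⟨ cong (_+ # (W ^⊥ ∧ ∁ (P ^⊥))) (cong₂ _+_
           (#-cong _ (P ∖ W) (λ { a (((_ , a∉) , _) , a∈) → a∈ , a∉ })
             (λ { a (a∈ , a∉) → ((⊥ˢ-⊆ W⊆P (singular⇒⊥ˢ sP a∈) , a∉) , singular⇒⊥ˢ sP a∈) , a∈ }))
           (#-cong _ (P ^⊥ ∧ ∁ (In P)) (λ { a ((_ , pa) , a∉) → pa , a∉ })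
             (λ { a (pa , a∉) → ((⊥ˢ-⊆ W⊆P pa , λ a∈ → a∉ (W⊆P a∈)) , pa) , a∉ }))) ⟩
    (# (P ∖ W) + # (P ^⊥ ∧ ∁ (In P))) + # (W ^⊥ ∧ ∁ (P ^⊥)) ∎
    where open ≡-Reasoning

  -- The number of points not collinear with a given point in a polar space of rank c + 1. It is the
  -- last summand in the recursion of `Q`, after the point itself and the s further points on each
  -- of the Q c lines through it.
  σ : ℕ → ℕ
  σ c = t * (s * s) ^ c

  -- Q c is the number of points of a polar space of rank c and order (s,…,s,t).
  Q : ℕ → ℕ
  Q zero    = 0
  Q (suc c) = suc (s * Q c + σ c)

  br1 : br 1 ≡ 1
  br1 = cong suc (*-zeroʳ s)

  Over : Sb → DecPred Sb
  Over W = (W ⊆_) by (W ⊆?_)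

  ∋ : Pt → DecPred Sb
  ∋ p = (p ∈_) by (p ∈?_)

  #-∖-hyperplane : ∀ {w W P} → W ⊆ P → Rk w W → Rk (suc w) P → # (P ∖ W) ≡ s ^ w
  #-∖-hyperplane {w} {W} {P} W⊆P rW rP = trans (#-∖ W⊆P rW (subst (λ k → Rk k P) (sym (+-comm w 1)) rP))
    (trans (cong (s ^ w *_) br1) (*-identityʳ _))

  module _ {w W} (w+1≡n : suc w ≡ n) (rW : Rk w W) where
    private
      wpos : suc (w ∸ 1) ≡ w
      wpos = m+[n∸m]≡n (≤-trans (s≤s z≤n) (s≤s⁻¹ (subst (3 ≤_) (sym w+1≡n) 3≤n)))
      n∸2 : n ∸ 2 ≡ w ∸ 1
      n∸2 = cong (_∸ 2) (sym w+1≡n)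
      ΔW : Δ G (n ∸ 2) W
      ΔW = subst (λ k → Δ G k W) (sym n∸2) (rank⇒Δ (subst (λ k → Rk k W) (sym wpos) rW))
      through = maxThrough W ΔW
      e = proj₁ through
      e-injective = proj₁ (proj₂ through)
      e-onto = proj₂ (proj₂ through)
      toΔ : ∀ {Z} → Rk n Z → Δ G (n ∸ 1) Z
      toΔ {Z} rZ = rank⇒Δ (subst (λ k → Rk k Z) (sym 1+n∸1) rZ)
      fromΔ : ∀ {Z} → Δ G (n ∸ 1) Z → Rk n Z
      fromΔ {Z} dZ = subst (λ k → Rk k Z) 1+n∸1 (Δ⇒rank dZ)

    #-maximals : # (Rank n ∧ Over W) ≡ suc t
    #-maximals = trans (sym (begin
      # {Fin (suc t)} everything ≡⟨ sym (*-identityʳ _) ⟩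
      # {Fin (suc t)} everything * 1
        ≡⟨ double-count everything (Rank n ∧ Over W) (λ k → is (e k)) 1 1 1
          (λ k _ → trans (*-identityʳ _) (#-unique ((Rank n ∧ Over W) ∧ is (e k)) (e k)
            (let d , W⊆ = proj₂ (e-onto (e k)) (k , refl) in (fromΔ d , λ {x} → W⊆ {x}) , refl) (λ _ → proj₂)))
          (λ Z rZ → let k , ek = proj₁ (e-onto Z) (toΔ (proj₁ rZ) , λ {x} → proj₂ rZ {x}) in
            #-unique _ k (_ , sym ek) (λ k' ek' → e-injective k' k (trans (sym (proj₂ ek')) (sym ek)))) ⟩
      # (Rank n ∧ Over W) * 1 * 1 ≡⟨ trans (*-identityʳ _) (*-identityʳ _) ⟩
      # (Rank n ∧ Over W) ∎)) (#-everything (suc t))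
      where open ≡-Reasoning

    -- A point of W^⊥ outside W lies in exactly one maximal subspace over W, namely its join with W.
    #-above-submaximal : # (W ^⊥ ∧ ∁ (In W)) ≡ suc t * s ^ w
    #-above-submaximal = begin
      # (W ^⊥ ∧ ∁ (In W))     ≡⟨ sym (*-identityʳ _) ⟩
      # (W ^⊥ ∧ ∁ (In W)) * 1 ≡⟨ double-count (W ^⊥ ∧ ∁ (In W)) (Rank n ∧ Over W) ∋ 1 1 (s ^ w) row col ⟩
      # (Rank n ∧ Over W) * s ^ w * 1 ≡⟨ *-identityʳ _ ⟩
      # (Rank n ∧ Over W) * s ^ w ≡⟨ cong (_* s ^ w) #-maximals ⟩
      suc t * s ^ w ∎
      where
      open ≡-Reasoning
      row : ∀ p → p ⊥ˢ W × ¬ p ∈ W → # ((Rank n ∧ Over W) ∧ ∋ p) * 1 ≡ 1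
      row p (pW , p∉) = trans (*-identityʳ _) (#-unique ((Rank n ∧ Over W) ∧ ∋ p) (J W p)
        ((rJ , λ {x} → X⊆J pW {x}) , p∈J)
        (λ { Z ((rZ , W⊆Z) , p∈Z) → sym (rank-≡ (J⊆ (singular rZ) p∉ W⊆Z p∈Z) rJ rZ) }))
        where
        rJ : Rk n (J W p)
        rJ = subst (λ k → Rk k (J W p)) w+1≡n (J-rank rW pW p∉)
      col : ∀ Z → Rk n Z × W ⊆ Z → # ((W ^⊥ ∧ ∁ (In W)) ∧ In Z) ≡ s ^ w
      col Z (rZ , W⊆Z) = trans (#-cong ((W ^⊥ ∧ ∁ (In W)) ∧ In Z) (Z ∖ W)
        (λ { a ((_ , a∉) , a∈) → a∈ , a∉ }) (λ { a (a∈ , a∉) → (⊥ˢ-⊆ W⊆Z (singular⇒⊥ˢ (singular rZ) a∈) , a∉) , a∈ }))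
        (#-∖-hyperplane W⊆Z rW (subst (λ k → Rk k Z) (sym w+1≡n) rZ))

  #-above-maximal : ∀ {M} → Rk n M → # (M ^⊥ ∧ ∁ (In M)) ≡ 0
  #-above-maximal rM = #-empty _ (λ { p (pM , p∉) → p∉ (maximal rM pM) })

  -- Exactly one of the s points other than p on each line through p is collinear with y.
  #-perp-with-opposite : ∀ {P p y} → Singular G P → p ∈ P → ¬ y ⊥ p →
    # ((P ^⊥ ∧ ∁ (In P)) ∧ ((_⊥ y) by (_⊥? y))) * s ≡ # (P ^⊥ ∧ ∁ (In P))
  #-perp-with-opposite {P} {p} {y} sP p∈P ¬yp =
    trans (double-count (A ∧ ⊥y) A (λ x' → OnLine p x') 1 s 1 row col) (trans (*-identityʳ _) (*-identityʳ _))
    where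
    A ⊥y : DecPred Pt
    A = P ^⊥ ∧ ∁ (In P)
    ⊥y = (_⊥ y) by (_⊥? y)
    lineIn : ∀ {ℓ x z} → Holds A x → p ∈ pts ℓ → x ∈ pts ℓ → z ∈ pts ℓ → z ≢ p → Holds A z
    lineIn {ℓ} {x} {z} (xP , x∉) p∈ℓ x∈ℓ z∈ℓ z≢p =
      ⊥ˢ-line (λ { refl → x∉ p∈P }) p∈ℓ x∈ℓ z∈ℓ (singular⇒⊥ˢ sP p∈P) xP ,
      λ z∈ → x∉ (proj₂ sP ℓ z p z≢p z∈ℓ p∈ℓ z∈ p∈P x∈ℓ)
    row : ∀ x' → Holds (A ∧ ⊥y) x' → # (A ∧ OnLine p x') * 1 ≡ s
    row x' (ax'@(x'P , x'∉) , _) with lineThrough (⊥-sym (x'P p p∈P)) (λ { refl → x'∉ p∈P })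
    ... | ℓ , p∈ℓ , x'∈ℓ = trans (*-identityʳ _) (trans (#-cong _ (In (pts ℓ) ∧ ∁ (is p)) to
          (λ { z (z∈ℓ , z≢p) → lineIn ax' p∈ℓ x'∈ℓ z∈ℓ z≢p , ℓ , p∈ℓ , z∈ℓ , x'∈ℓ })) (#-line∖point p∈ℓ))
      where
      to : ∀ z → Holds (A ∧ OnLine p x') z → z ∈ pts ℓ × z ≢ p
      to z ((_ , z∉) , ℓ' , p∈ℓ' , z∈ℓ' , x'∈ℓ')
        with partialLinear ℓ' ℓ p x' (λ { refl → x'∉ p∈P }) p∈ℓ' x'∈ℓ' p∈ℓ x'∈ℓ
      ... | refl = z∈ℓ' , λ { refl → z∉ p∈P }
    col : ∀ x → Holds A x →
      # ((A ∧ ⊥y) ∧ ((λ x' → Holds (OnLine p x') x) by (λ x' → dec (OnLine p x') x))) ≡ 1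
    col x ax@(xP , x∉) with lineThrough (⊥-sym (xP p p∈P)) (λ { refl → x∉ p∈P })
    ... | ℓ , p∈ℓ , x∈ℓ with foot y p∈ℓ
    ... | x' , x'∈ℓ , yx' = #-unique _ x'
          ((lineIn ax p∈ℓ x∈ℓ x'∈ℓ (λ { refl → ¬yp yx' }) , ⊥-sym yx') , ℓ , p∈ℓ , x∈ℓ , x'∈ℓ) uniq
      where
      uniq : ∀ z → (Holds A z × z ⊥ y) × Holds (OnLine p z) x → z ≡ x'
      uniq z ((_ , zy) , ℓ' , p∈ℓ' , x∈ℓ' , z∈ℓ')
        with partialLinear ℓ' ℓ p x (λ { refl → x∉ p∈P }) p∈ℓ' x∈ℓ' p∈ℓ x∈ℓ
      ... | refl = foot-unique p∈ℓ ¬yp z∈ℓ' x'∈ℓ (⊥-sym zy) yx'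

  nonPerp-arithmetic : ∀ s t a q k → s * a * q * (s * a * (t * k)) ≡ a * (t * (s * s * k)) * (a * q)
  nonPerp-arithmetic = solve-∀

  above-arithmetic : ∀ s a q k → a + s * a * q + a * k ≡ a * suc (s * q + k)
  above-arithmetic = solve-∀

  -- Both count in the residue of W without forming it: a point of the residue accounts for s^w
  -- points outside W. For `NonPerpCount` the residue has rank c + 1 and P is one of its points; σ c
  -- is the number of points opposite to it.
  NonPerpCount AboveCount : ℕ → Set
  NonPerpCount c = ∀ {w W P} → suc w + c ≡ n → W ⊆ P → Rk w W → Rk (suc w) P → # (W ^⊥ ∧ ∁ (P ^⊥)) ≡ s ^ w * σ c
  AboveCount c = ∀ {w W} → w + c ≡ n → Rk w W → # (W ^⊥ ∧ ∁ (In W)) ≡ s ^ w * Q c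

  -- P is maximal, so P^⊥ has no points outside P, and of the t + 1 maximal subspaces over W the t
  -- different from P remain.
  nonPerp-zero : NonPerpCount 0
  nonPerp-zero {w} {W} {P} eq W⊆P rW rP = +-cancelˡ-≡ (s ^ w) _ _ (begin
    s ^ w + # (W ^⊥ ∧ ∁ (P ^⊥))
      ≡⟨ cong (_+ # (W ^⊥ ∧ ∁ (P ^⊥))) (sym (trans (cong₂ _+_ (#-∖-hyperplane W⊆P rW rP) (#-above-maximal rP'))
           (+-identityʳ _))) ⟩
    # (P ∖ W) + # (P ^⊥ ∧ ∁ (In P)) + # (W ^⊥ ∧ ∁ (P ^⊥)) ≡⟨ sym (flag-decomposition (singular rP) W⊆P) ⟩
    # (W ^⊥ ∧ ∁ (In W))  ≡⟨ #-above-submaximal eq' rW ⟩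
    s ^ w + t * s ^ w    ≡⟨ cong (s ^ w +_) (trans (*-comm t _) (cong (s ^ w *_) (sym (*-identityʳ t)))) ⟩
    s ^ w + s ^ w * σ 0  ∎)
    where
    open ≡-Reasoning
    eq' : suc w ≡ n
    eq' = trans (sym (+-identityʳ _)) eq
    rP' : Rk n P
    rP' = subst (λ k → Rk k P) eq' rP
  -- Double counting of collinear pairs (x, y) with x in P^⊥ outside P and y in W^⊥ outside P^⊥. For
  -- fixed x, the pair W ⊆ P is replaced by its joins with x, which lowers c; for fixed y, one in s
  -- of the points x is collinear with y.
  nonPerp-suc : ∀ c → NonPerpCount c → AboveCount (suc c) → NonPerpCount (suc c)
  nonPerp-suc c nonPerp above {w} {W} {P} eq W⊆P rW rP =
    *-cancelʳ-≡ _ _ (s ^ w * Q (suc c)) {{m*n≢0 (s ^ w) (Q (suc c)) {{m^n≢0 s w}}}} (begin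
      # B * (s ^ w * Q (suc c))            ≡⟨ sym (*-identityʳ _) ⟩
      # B * (s ^ w * Q (suc c)) * 1
        ≡⟨ sym (double-count A B (λ x → (x ⊥_) by (x ⊥?_)) 1 (s ^ suc w * σ c) (s ^ w * Q (suc c)) row col) ⟩
      # A * (s ^ suc w * σ c)              ≡⟨ cong (_* (s ^ suc w * σ c)) (above eq rP) ⟩
      s ^ suc w * Q (suc c) * (s ^ suc w * σ c) ≡⟨ nonPerp-arithmetic s t (s ^ w) (Q (suc c)) ((s * s) ^ c) ⟩
      s ^ w * σ (suc c) * (s ^ w * Q (suc c)) ∎)
    where
    open ≡-Reasoning
    A B : DecPred Pt
    A = P ^⊥ ∧ ∁ (In P)
    B = W ^⊥ ∧ ∁ (P ^⊥)
    row : ∀ x → Holds A x → # (B ∧ ((x ⊥_) by (x ⊥?_))) * 1 ≡ s ^ suc w * σ c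
    row x (xP , x∉) = trans (*-identityʳ _) (trans
      (#-cong (B ∧ ((x ⊥_) by (x ⊥?_))) (J W x ^⊥ ∧ ∁ (J P x ^⊥))
        (λ { y ((yW , ¬yP) , xy) → ⊥ˢ-J x∉W yW (⊥-sym xy) , λ yJ → ¬yP (⊥ˢ-⊆ (X⊆J xP) yJ) })
        (λ { y (yJ , ¬yJ) → (⊥ˢ-⊆ (X⊆J xW) yJ , λ yP → ¬yJ (⊥ˢ-J x∉ yP (yJ x p∈J))) , ⊥-sym (yJ x p∈J) }))
      (nonPerp (trans (sym (cong suc (+-suc w c))) eq)
        (J⊆ (singular rJP) x∉W (λ a∈ → X⊆J xP (W⊆P a∈)) p∈J) (J-rank rW xW x∉W) rJP))
      where
      xW = ⊥ˢ-⊆ W⊆P xP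
      x∉W = λ x∈ → x∉ (W⊆P x∈)
      rJP = J-rank rP xP x∉
    col : ∀ y → Holds B y → # (A ∧ ((_⊥ y) by (_⊥? y))) ≡ s ^ w * Q (suc c)
    col y (yW , ¬yP) =
      let p , p∈P , p∉W = pointOutside rW rP ≤-refl
          pW = ⊥ˢ-⊆ W⊆P (singular⇒⊥ˢ (singular rP) p∈P)
          J≡P = rank-≡ (J⊆ (singular rP) p∉W W⊆P p∈P) (J-rank rW pW p∉W) rP
      in *-cancelʳ-≡ _ _ s (begin
        # (A ∧ ((_⊥ y) by (_⊥? y))) * s
          ≡⟨ #-perp-with-opposite (singular rP) p∈P (λ yp → ¬yP (subst (y ⊥ˢ_) J≡P (⊥ˢ-J p∉W yW yp))) ⟩
        # A                   ≡⟨ above eq rP ⟩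
        s * s ^ w * Q (suc c) ≡⟨ *-assoc s (s ^ w) _ ⟩
        s * (s ^ w * Q (suc c)) ≡⟨ *-comm s _ ⟩
        s ^ w * Q (suc c) * s ∎)

  above-zero : AboveCount 0
  above-zero {w} {W} eq rW = trans
    (#-above-maximal (subst (λ k → Rk k W) (trans (sym (+-identityʳ w)) eq) rW)) (sym (*-zeroʳ (s ^ w)))
  -- The join P of W with any further point yields the three summands of the recursion for `Q`: the
  -- points of P, those over P, and those not perpendicular to P.
  above-suc : ∀ c → NonPerpCount c → AboveCount c → AboveCount (suc c)
  above-suc c nonPerp above {w} {W} eq rW =
    let p , pW , p∉ = extendable rW (subst (w <_) eq (m<m+n w (s≤s z≤n)))
        eq' = trans (sym (+-suc w c)) eq
        rJ = J-rank rW pW p∉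
    in begin
      # (W ^⊥ ∧ ∁ (In W)) ≡⟨ flag-decomposition (singular rJ) (X⊆J pW) ⟩
      # (J W p ∖ W) + # (J W p ^⊥ ∧ ∁ (In (J W p))) + # (W ^⊥ ∧ ∁ (J W p ^⊥))
        ≡⟨ cong₂ _+_ (cong₂ _+_ (#-∖-hyperplane (X⊆J pW) rW rJ) (above eq' rJ)) (nonPerp eq' (X⊆J pW) rW rJ) ⟩
      s ^ w + s ^ suc w * Q c + s ^ w * σ c ≡⟨ above-arithmetic s (s ^ w) (Q c) (σ c) ⟩
      s ^ w * Q (suc c) ∎
    where open ≡-Reasoning

  -- The two families are interleaved: stage c + 1 of `AboveCount` needs stage c of both, and stage
  -- c + 1 of `NonPerpCount` needs the new `AboveCount`.
  perp-counts : ∀ c → NonPerpCount c × AboveCount c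
  perp-counts zero    = nonPerp-zero , above-zero
  perp-counts (suc c) =
    let nonPerp , above = perp-counts c
        above' = above-suc c nonPerp above
    in nonPerp-suc c nonPerp above' , above'

  #-nonPerp : ∀ c → NonPerpCount c
  #-nonPerp c = proj₁ (perp-counts c)

  #-above : ∀ c → AboveCount c
  #-above c = proj₂ (perp-counts c)

  -- Gaussian factorials and subspaces of given rank

  fac : ℕ → ℕ
  fac zero    = 1
  fac (suc d) = br (suc d) * fac d

  -- Dividing by `fac d` gives the Gaussian binomial coefficient of e and d. For d > e the factor
  -- `br 0` makes the product vanish, so the truncated `e ∸ 1` is harmless.
  falling : ℕ → ℕ → ℕ
  falling e zero    = 1
  falling e (suc d) = br e * falling (e ∸ 1) d

  fac-nonZero : ∀ d → NonZero (fac d)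
  fac-nonZero zero    = _
  fac-nonZero (suc d) = m*n≢0 (br (suc d)) (fac d) {{_}} {{fac-nonZero d}}

  falling*fac : ∀ d e → falling (d + e) d * fac e ≡ fac (d + e)
  falling*fac zero    e = +-identityʳ _
  falling*fac (suc d) e = trans (*-assoc (br (suc (d + e))) (falling (d + e) d) (fac e)) (cong (br (suc (d + e)) *_) (falling*fac d e))

  Under : Sb → DecPred Sb
  Under X = (_⊆ X) by (_⊆? X)

  Between : Sb → Sb → ℕ → DecPred Sb
  Between Z X r = Rank r ∧ Over Z ∧ Under X

  cast : ∀ {a b X} → a ≡ b → Rk a X → Rk b X
  cast {X = X} = subst (λ k → Rk k X)

  between-arithmetic : ∀ a x y b f → a * x * y ≡ b * (a * f) → .{{NonZero a}} → b * f ≡ x * y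
  between-arithmetic a x y b f e = *-cancelˡ-≡ _ _ a (trans (swap a b f) (trans (sym e) (*-assoc a x y)))
    where
    swap : ∀ a b f → a * (b * f) ≡ b * (a * f)
    swap = solve-∀

  -- Double counting of pairs (y, Y) with y in Y outside Z: fixing y replaces Z by its join with y,
  -- and fixing Y leaves s^z [d+1] points.
  #-between : ∀ d {e m z X Z} → z + e ≡ m → Z ⊆ X → Rk z Z → Rk m X →
    # (Between Z X (z + d)) * fac d ≡ falling e d
  #-between zero {e} {m} {z} {X} {Z} eq Z⊆X rZ rX = trans (*-identityʳ _)
    (#-unique (Between Z X (z + 0)) Z (cast (sym (+-identityʳ z)) rZ , (λ x∈ → x∈) , (λ {x} → Z⊆X {x}))
      (λ { Y (rY , Z⊆Y , _) → sym (rank-≡ Z⊆Y rZ (cast (+-identityʳ z) rY)) }))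
  #-between (suc d) {e} {m} {z} {X} {Z} eq Z⊆X rZ rX =
    between-arithmetic (s ^ z) (br e) (falling (e ∸ 1) d) (# Bt) (fac (suc d)) (begin
      s ^ z * br e * falling (e ∸ 1) d     ≡⟨ cong (_* falling (e ∸ 1) d) (sym (#-∖ Z⊆X rZ (cast (sym eq) rX))) ⟩
      # (X ∖ Z) * falling (e ∸ 1) d        ≡⟨ double-count (X ∖ Z) Bt ∋ (fac d) _ (s ^ z * br (suc d)) row col ⟩
      # Bt * (s ^ z * br (suc d)) * fac d  ≡⟨ *-assoc (# Bt) _ _ ⟩
      # Bt * (s ^ z * br (suc d) * fac d)  ≡⟨ cong (# Bt *_) (*-assoc (s ^ z) _ _) ⟩
      # Bt * (s ^ z * fac (suc d))         ∎) {{m^n≢0 s z}}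
    where
    open ≡-Reasoning
    Bt : DecPred Sb
    Bt = Between Z X (z + suc d)
    shift : ∀ e → z + e ≡ m → ∀ y → Holds (X ∖ Z) y → suc z + (e ∸ 1) ≡ m
    shift zero    eq y (y∈X , y∉Z) = ⊥-elim (y∉Z (subst (y ∈_)
      (sym (rank-≡ Z⊆X rZ (cast (trans (sym eq) (+-identityʳ z)) rX))) y∈X))
    shift (suc e) eq _ _ = trans (sym (+-suc z e)) eq
    row : ∀ y → Holds (X ∖ Z) y → # (Bt ∧ ∋ y) * fac d ≡ falling (e ∸ 1) d
    row y y∈@(y∈X , y∉Z) = trans (cong (_* fac d) (#-cong (Bt ∧ ∋ y) (Between (J Z y) X (suc z + d))
        (λ { Y ((rY , Z⊆Y , Y⊆X) , y∈Y) → cast (+-suc z d) rY , J⊆ (singular rY) y∉Z Z⊆Y y∈Y , (λ {x} → Y⊆X {x}) })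
        (λ { Y (rY , J⊆Y , Y⊆X) → (cast (sym (+-suc z d)) rY , (λ x∈ → J⊆Y (X⊆J yZ x∈)) , (λ {x} → Y⊆X {x})) , J⊆Y p∈J })))
      (#-between d (shift e eq y y∈) (J⊆ (singular rX) y∉Z Z⊆X y∈X) (J-rank rZ yZ y∉Z) rX)
      where
      yZ : y ⊥ˢ Z
      yZ = ⊥ˢ-⊆ Z⊆X (singular⇒⊥ˢ (singular rX) y∈X)
    col : ∀ Y → Holds Bt Y → # ((X ∖ Z) ∧ In Y) ≡ s ^ z * br (suc d)
    col Y (rY , Z⊆Y , Y⊆X) = trans (#-cong ((X ∖ Z) ∧ In Y) (Y ∖ Z)
      (λ { a ((_ , a∉) , a∈) → a∈ , a∉ }) (λ { a (a∈ , a∉) → (Y⊆X a∈ , a∉) , a∈ })) (#-∖ Z⊆Y rZ rY)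

  -- Symmetry of the Gaussian binomial coefficient. The form in terms of the codimension a keeps the
  -- number of factors fixed when the rank changes, as the later comparisons require.
  #-subspaces : ∀ b a {X} → Rk (b + a) X → # (Between ∅ X b) * fac a ≡ falling (b + a) a
  #-subspaces b a {X} rX = *-cancelʳ-≡ _ _ (fac b) {{fac-nonZero b}} (begin
    # (Between ∅ X b) * fac a * fac b   ≡⟨ swap (# (Between ∅ X b)) (fac a) (fac b) ⟩
    # (Between ∅ X b) * fac b * fac a   ≡⟨ cong (_* fac a) (#-between b refl (λ x∈ → ⊥-elim (∉⊥ x∈)) ∅-rank rX) ⟩
    falling (b + a) b * fac a           ≡⟨ falling*fac b a ⟩
    fac (b + a)                         ≡⟨ cong fac (+-comm b a) ⟩
    fac (a + b)                         ≡⟨ sym (falling*fac a b) ⟩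
    falling (a + b) a * fac b           ≡⟨ cong (λ m → falling m a * fac b) (+-comm a b) ⟩
    falling (b + a) a * fac b           ∎)
    where
    open ≡-Reasoning
    swap : ∀ x y z → x * y * z ≡ x * z * y
    swap = solve-∀

  -- Subspaces of equal rank, sorted by perpendicularity to X and meet with X

  PerpTo : Sb → DecPred Sb
  PerpTo X = Perp G X by (λ Y → Finₚ.all? λ p → Finₚ.all? λ q → (p ∈? X) →-dec ((q ∈? Y) →-dec (p ⊥? q)))

  Meet : Sb → Sb → DecPred Sb
  Meet X Z = (λ Y → Y ∩ X ≡ Z) by (λ Y → (Y ∩ X) ≟ Z)

  MeetRank : Sb → ℕ → DecPred Sb
  MeetRank X b = (λ Y → Rk b (Y ∩ X)) by (λ Y → dec (Rank b) (Y ∩ X))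

  Ext : Sb → Sb → ℕ → DecPred Sb
  Ext X Z r = Rank r ∧ Meet X Z ∧ PerpTo X

  perp⇒⊥ˢ : ∀ {X Y y} → Perp G X Y → y ∈ Y → y ⊥ˢ X
  perp⇒⊥ˢ XY y∈ x x∈ = ⊥-sym (XY x _ x∈ y∈)

  ⊥ˢ⇒perp : ∀ {X Y} → (∀ {y} → y ∈ Y → y ⊥ˢ X) → Perp G X Y
  ⊥ˢ⇒perp YX x y x∈ y∈ = ⊥-sym (YX y∈ x x∈)

  meet-⊆ : ∀ {X Y Z : Sb} → Y ∩ X ≡ Z → Z ⊆ Y
  meet-⊆ {X} {Y} refl = p∩q⊆p Y X

  meet⁺ : ∀ {X Y Z : Sb} {x} → Y ∩ X ≡ Z → x ∈ Y → x ∈ X → x ∈ Z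
  meet⁺ refl x∈Y x∈X = x∈p∩q⁺ (x∈Y , x∈X)

  -- The modular law for X, Y and y ∈ Y ∖ X.
  join-meet : ∀ {X Y Z y} → Singular G Y → Z ⊆ X → y ⊥ˢ X → ¬ y ∈ X → Y ∩ X ≡ Z → y ∈ Y → Y ∩ J X y ≡ J Z y
  join-meet {X} {Y} {Z} {y} sY Z⊆X yX y∉ e y∈Y = ⊆-antisym left right
    where
    left : Y ∩ J X y ⊆ J Z y
    left {q} q∈ with x∈p∩q⁻ Y (J X y) q∈
    ... | q∈Y , q∈J with q ≟ y | ∈J⁻ q∈J
    ... | yes q≡y | _ = ∈J⁺ (inj₁ q≡y)
    ... | no q≢y | inj₁ q≡y = ⊥-elim (q≢y q≡y)
    ... | no q≢y | inj₂ (x , x∈X , ℓ , y∈ℓ , x∈ℓ , q∈ℓ) =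
      ∈J⁺ (inj₂ (x , meet⁺ e (proj₂ sY ℓ q y q≢y q∈ℓ y∈ℓ q∈Y y∈Y x∈ℓ) x∈X , ℓ , y∈ℓ , x∈ℓ , q∈ℓ))
    right : J Z y ⊆ Y ∩ J X y
    right q∈ = x∈p∩q⁺ (J⊆ sY (λ y∈ → y∉ (Z⊆X y∈)) (meet-⊆ e) y∈Y q∈ , J-mono (∈J⁻ q∈))
      where
      J-mono : ∀ {q} → OnJoin Z y q → q ∈ J X y
      J-mono (inj₁ e)              = ∈J⁺ (inj₁ e)
      J-mono (inj₂ (x , x∈ , r)) = ∈J⁺ (inj₂ (x , Z⊆X x∈ , r))

  -- A line joining y to a point of Z has at most one point in X, since two would put y into X.
  J-∩ : ∀ {X Z y q} → Singular G X → Z ⊆ X → ¬ y ∈ X → q ∈ J Z y → q ∈ X → q ∈ Z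
  J-∩ {q = q} sX Z⊆X y∉ q∈J q∈X with ∈J⁻ q∈J
  ... | inj₁ refl = ⊥-elim (y∉ q∈X)
  ... | inj₂ (x , x∈ , ℓ , y∈ℓ , x∈ℓ , q∈ℓ) with q ≟ x
  ...   | yes refl = x∈
  ...   | no q≢x   = ⊥-elim (y∉ (proj₂ sX ℓ q x q≢x q∈ℓ x∈ℓ q∈X (Z⊆X x∈) y∈ℓ))

  join-meet⁻ : ∀ {X Y Z y} → Singular G X → Z ⊆ X → y ⊥ˢ X → ¬ y ∈ X → Y ∩ J X y ≡ J Z y → Y ∩ X ≡ Z
  join-meet⁻ {X} {Y} {Z} {y} sX Z⊆X yX y∉ e = ⊆-antisym
    (λ q∈ → J-∩ sX Z⊆X y∉ (meet⁺ e (p∩q⊆p Y X q∈) (X⊆J yX (p∩q⊆q Y X q∈))) (p∩q⊆q Y X q∈))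
    (λ x∈ → x∈p∩q⁺ (meet-⊆ e (X⊆J (⊥ˢ-⊆ Z⊆X yX) x∈) , Z⊆X x∈))

  -- The product s^(ad) Q_c Q_(c-1) ⋯ Q_(c-d+1); its power of s becomes s^(a²) at d = a.
  K : ℕ → ℕ → ℕ → ℕ
  K c a zero    = 1
  K c a (suc d) = s ^ a * Q c * K (c ∸ 1) a d

  -- Double counting of pairs (y, Y) with y in Y outside X. Fixing y replaces X and Z by their joins
  -- with y; by the modular law this keeps the condition on the meet. The codimension a of Z in X
  -- stays while c and d drop, so a and d must be separate parameters although they start out equal.
  #-ext : ∀ d {a c z X Z} → (z + a) + c ≡ n → Z ⊆ X → Rk z Z → Rk (z + a) X →
    # (Ext X Z (z + d)) * fac d ≡ K c a d
  #-ext zero {a} {c} {z} {X} {Z} eq Z⊆X rZ rX = trans (*-identityʳ _)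
    (#-unique (Ext X Z (z + 0)) Z
      ( cast (sym (+-identityʳ z)) rZ
      , ⊆-antisym (p∩q⊆p Z X) (λ x∈ → x∈p∩q⁺ (x∈ , Z⊆X x∈))
      , ⊥ˢ⇒perp (λ y∈ → singular⇒⊥ˢ (singular rX) (Z⊆X y∈)))
      (λ { Y (rY , e , _) → sym (rank-≡ (meet-⊆ e) rZ (cast (+-identityʳ z) rY)) }))
  #-ext (suc d) {a} {c} {z} {X} {Z} eq Z⊆X rZ rX =
    between-arithmetic (s ^ z) (s ^ a * Q c) (K (c ∸ 1) a d) (# Ex) (fac (suc d)) (begin
      s ^ z * (s ^ a * Q c) * K (c ∸ 1) a d
        ≡⟨ cong (_* K (c ∸ 1) a d) (trans (sym (*-assoc (s ^ z) (s ^ a) (Q c))) (trans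
             (cong (_* Q c) (sym (^-distribˡ-+-* s z a))) (sym (#-above c eq rX)))) ⟩
      # (X ^⊥ ∧ ∁ (In X)) * K (c ∸ 1) a d
        ≡⟨ double-count (X ^⊥ ∧ ∁ (In X)) Ex ∋ (fac d) _ (s ^ z * br (suc d)) row col ⟩
      # Ex * (s ^ z * br (suc d)) * fac d  ≡⟨ *-assoc (# Ex) _ _ ⟩
      # Ex * (s ^ z * br (suc d) * fac d)  ≡⟨ cong (# Ex *_) (*-assoc (s ^ z) _ _) ⟩
      # Ex * (s ^ z * fac (suc d))         ∎) {{m^n≢0 s z}}
    where
    open ≡-Reasoning
    Ex : DecPred Sb
    Ex = Ext X Z (z + suc d)
    shift : ∀ c → (z + a) + c ≡ n → ∀ {y} → y ⊥ˢ X → ¬ y ∈ X → (suc z + a) + (c ∸ 1) ≡ n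
    shift zero    eq yX y∉ = ⊥-elim (y∉ (maximal (cast (trans (sym (+-identityʳ (z + a))) eq) rX) yX))
    shift (suc c) eq _ _   = trans (sym (+-suc (z + a) c)) eq
    row : ∀ y → y ⊥ˢ X × ¬ y ∈ X → # (Ex ∧ ∋ y) * fac d ≡ K (c ∸ 1) a d
    row y (yX , y∉) = trans (cong (_* fac d) (#-cong (Ex ∧ ∋ y) (Ext (J X y) (J Z y) (suc z + d))
        (λ { Y ((rY , e , XY) , y∈Y) → cast (+-suc z d) rY , join-meet (singular rY) Z⊆X yX y∉ e y∈Y ,
               ⊥ˢ⇒perp (λ b∈ → ⊥ˢ-J y∉ (perp⇒⊥ˢ XY b∈) (singular⇒⊥ˢ (singular rY) b∈ y y∈Y)) })
        (λ { Y (rY , e , JY) → (cast (sym (+-suc z d)) rY , join-meet⁻ (singular rX) Z⊆X yX y∉ e ,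
               ⊥ˢ⇒perp (λ b∈ → ⊥ˢ-⊆ (X⊆J yX) (perp⇒⊥ˢ JY b∈))) , meet-⊆ e p∈J })))
      (#-ext d (shift c eq yX y∉) (J⊆ (singular rJX) y∉Z (λ x∈ → X⊆J yX (Z⊆X x∈)) p∈J)
        (J-rank rZ (⊥ˢ-⊆ Z⊆X yX) y∉Z) rJX)
      where
      rJX : Rk (suc (z + a)) (J X y)
      rJX = J-rank rX yX y∉
      y∉Z : ¬ y ∈ Z
      y∉Z y∈ = y∉ (Z⊆X y∈)
    col : ∀ Y → Holds Ex Y → # ((X ^⊥ ∧ ∁ (In X)) ∧ In Y) ≡ s ^ z * br (suc d)
    col Y (rY , e , XY) = trans (#-cong ((X ^⊥ ∧ ∁ (In X)) ∧ In Y) (Y ∖ Z)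
      (λ { a ((_ , a∉) , a∈) → a∈ , λ a∈Z → a∉ (Z⊆X a∈Z) })
      (λ { a (a∈ , a∉) → (perp⇒⊥ˢ XY a∈ , λ a∈X → a∉ (meet⁺ e a∈ a∈X)) , a∈ })) (#-∖ (meet-⊆ e) rZ rY)

  Stratum : Sb → ℕ → ℕ → DecPred Sb
  Stratum X m b = (Rank m ∧ PerpTo X) ∧ MeetRank X b

  -- Each Y determines its meet Z with X. The number of choices of Z has denominator [a]!, and so
  -- has the number of Y for each Z; hence the square in A_a.
  #-stratum : ∀ b a k {X} → (b + a) + k ≡ n → Rk (b + a) X →
    # (Stratum X (b + a) b) * (fac a * fac a) ≡ falling (b + a) a * K k a a
  #-stratum b a k {X} eq rX = begin
    # St * (fac a * fac a)        ≡⟨ sym (*-assoc (# St) _ _) ⟩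
    # St * fac a * fac a          ≡⟨ cong (λ z → z * fac a * fac a) (sym (*-identityʳ (# St))) ⟩
    # St * 1 * fac a * fac a      ≡⟨ cong (_* fac a) (sym (double-count (Between ∅ X b) St (Meet X) (fac a) _ 1 row col)) ⟩
    # (Between ∅ X b) * K k a a * fac a ≡⟨ swap (# (Between ∅ X b)) (K k a a) (fac a) ⟩
    # (Between ∅ X b) * fac a * K k a a ≡⟨ cong (_* K k a a) (#-subspaces b a rX) ⟩
    falling (b + a) a * K k a a   ∎
    where
    open ≡-Reasoning
    St : DecPred Sb
    St = Stratum X (b + a) b
    swap : ∀ x y z → x * y * z ≡ x * z * y
    swap = solve-∀
    row : ∀ Z → Holds (Between ∅ X b) Z → # (St ∧ Meet X Z) * fac a ≡ K k a a
    row Z (rZ , _ , Z⊆X) = trans (cong (_* fac a) (#-cong (St ∧ Meet X Z) (Ext X Z (b + a))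
      (λ { Y (((rY , XY) , _) , e) → rY , e , XY })
      (λ { Y (rY , e , XY) → ((rY , XY) , subst (Rk b) (sym e) rZ) , e }))) (#-ext a eq Z⊆X rZ rX)
    col : ∀ Y → Holds St Y → # (Between ∅ X b ∧ ((λ Z → Y ∩ X ≡ Z) by (λ Z → (Y ∩ X) ≟ Z))) ≡ 1
    col Y (_ , rM) = #-unique _ (Y ∩ X) ((rM , (λ x∈ → ⊥-elim (∉⊥ x∈)) , p∩q⊆q Y X) , refl) (λ { Z (_ , e) → sym e })

  -- One point of Y outside U perpendicular to X would make all of Y perpendicular to X. Thus all
  -- s^b points of Y outside U lie in U^⊥ but not in X^⊥, and each of them recovers Y as its join
  -- with U.
  #-nonPerp-over : ∀ b k {X U} → suc b + k ≡ n → U ⊆ X → Rk b U → Rk (suc b) X →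
    # (Rank (suc b) ∧ Meet X U ∧ ∁ (PerpTo X)) ≡ σ k
  #-nonPerp-over b k {X} {U} eq U⊆X rU rX = *-cancelʳ-≡ _ _ (s ^ b) {{m^n≢0 s b}} (begin
    # Y' * s ^ b                ≡⟨ sym (*-identityʳ _) ⟩
    # Y' * s ^ b * 1            ≡⟨ sym (double-count (U ^⊥ ∧ ∁ (X ^⊥)) Y' ∋ 1 1 (s ^ b) row col) ⟩
    # (U ^⊥ ∧ ∁ (X ^⊥)) * 1     ≡⟨ *-identityʳ _ ⟩
    # (U ^⊥ ∧ ∁ (X ^⊥))         ≡⟨ #-nonPerp k eq U⊆X rU rX ⟩
    s ^ b * σ k                 ≡⟨ *-comm (s ^ b) _ ⟩
    σ k * s ^ b                 ∎)
    where
    open ≡-Reasoning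
    Y' : DecPred Sb
    Y' = Rank (suc b) ∧ Meet X U ∧ ∁ (PerpTo X)
    row : ∀ y → y ⊥ˢ U × ¬ y ⊥ˢ X → # (Y' ∧ ∋ y) * 1 ≡ 1
    row y (yU , ¬yX) = trans (*-identityʳ _) (#-unique (Y' ∧ ∋ y) (J U y)
      ((rJ , ⊆-antisym (λ q∈ → J-∩ (singular rX) U⊆X y∉X (p∩q⊆p (J U y) X q∈) (p∩q⊆q (J U y) X q∈))
        (λ x∈ → x∈p∩q⁺ (X⊆J yU x∈ , U⊆X x∈)) , λ XJ → ¬yX (perp⇒⊥ˢ XJ p∈J)) , p∈J)
      (λ { Y ((rY , e , _) , y∈Y) → sym (rank-≡ (J⊆ (singular rY) y∉ (meet-⊆ e) y∈Y) rJ rY) }))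
      where
      y∉X : ¬ y ∈ X
      y∉X y∈ = ¬yX (singular⇒⊥ˢ (singular rX) y∈)
      y∉ : ¬ y ∈ U
      y∉ y∈ = y∉X (U⊆X y∈)
      rJ = J-rank rU yU y∉
    col : ∀ Y → Holds Y' Y → # ((U ^⊥ ∧ ∁ (X ^⊥)) ∧ In Y) ≡ s ^ b
    col Y (rY , e , ¬XY) = trans (#-cong ((U ^⊥ ∧ ∁ (X ^⊥)) ∧ In Y) (Y ∖ U)
      (λ { y ((_ , ¬yX) , y∈) → y∈ , λ y∈U → ¬yX (singular⇒⊥ˢ (singular rX) (U⊆X y∈U)) })
      (λ { y (y∈ , y∉) → (yU y∈ , λ yX → ¬XY (spread y∈ y∉ yX)) , y∈ }))
      (#-∖-hyperplane (meet-⊆ e) rU rY)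
      where
      yU : ∀ {y} → y ∈ Y → y ⊥ˢ U
      yU y∈ = ⊥ˢ-⊆ (meet-⊆ e) (singular⇒⊥ˢ (singular rY) y∈)
      spread : ∀ {y} → y ∈ Y → ¬ y ∈ U → y ⊥ˢ X → Perp G X Y
      spread {y} y∈ y∉ yX x z x∈ z∈ =
        ⊥ˢ-J y∉ (⊥ˢ-⊆ U⊆X (singular⇒⊥ˢ (singular rX) x∈)) (⊥-sym (yX x x∈)) z
          (subst (z ∈_) (sym (rank-≡ (J⊆ (singular rY) y∉ (meet-⊆ e) y∈) (J-rank rU (yU y∈) y∉) rY)) z∈)

  ApproxNonPerp : Sb → ℕ → DecPred Sb
  ApproxNonPerp X b = (Rank (suc b) ∧ MeetRank X b) ∧ ∁ (PerpTo X)

  #-approxNonPerp : ∀ b k {X} → suc b + k ≡ n → Rk (suc b) X → # (ApproxNonPerp X b) ≡ br (suc b) * σ k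
  #-approxNonPerp b k {X} eq rX = begin
    # Ap                      ≡⟨ sym (trans (*-identityʳ _) (*-identityʳ _)) ⟩
    # Ap * 1 * 1              ≡⟨ sym (double-count (Between ∅ X b) Ap (Meet X) 1 _ 1 row col) ⟩
    # (Between ∅ X b) * σ k   ≡⟨ cong (_* σ k) hyperplanes ⟩
    br (suc b) * σ k          ∎
    where
    open ≡-Reasoning
    Ap : DecPred Sb
    Ap = ApproxNonPerp X b
    hyperplanes : # (Between ∅ X b) ≡ br (suc b)
    hyperplanes = begin
      # (Between ∅ X b)         ≡⟨ sym (*-identityʳ _) ⟩
      # (Between ∅ X b) * 1     ≡⟨ cong (# (Between ∅ X b) *_) (sym (trans (*-identityʳ (br 1)) br1)) ⟩
      # (Between ∅ X b) * fac 1 ≡⟨ #-subspaces b 1 (cast (+-comm 1 b) rX) ⟩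
      br (b + 1) * 1            ≡⟨ *-identityʳ _ ⟩
      br (b + 1)                ≡⟨ cong br (+-comm b 1) ⟩
      br (suc b) ∎
    row : ∀ Z → Holds (Between ∅ X b) Z → # (Ap ∧ Meet X Z) * 1 ≡ σ k
    row Z (rZ , _ , Z⊆X) = trans (*-identityʳ _) (trans (#-cong (Ap ∧ Meet X Z) (Rank (suc b) ∧ Meet X Z ∧ ∁ (PerpTo X))
      (λ { Y (((rY , _) , ¬XY) , e) → rY , e , ¬XY })
      (λ { Y (rY , e , ¬XY) → ((rY , subst (Rk b) (sym e) rZ) , ¬XY) , e })) (#-nonPerp-over b k eq Z⊆X rZ rX))
    col : ∀ Y → Holds Ap Y → # (Between ∅ X b ∧ ((λ Z → Y ∩ X ≡ Z) by (λ Z → (Y ∩ X) ≟ Z))) ≡ 1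
    col Y ((_ , rM) , _) = #-unique _ (Y ∩ X) ((rM , (λ x∈ → ⊥-elim (∉⊥ x∈)) , p∩q⊆q Y X) , refl) (λ { Z (_ , e) → sym e })

  -- Inequalities between the counts

  σ>0 : ∀ c → 0 < σ c
  σ>0 c = *-mono-≤ t>0 (m^n>0 (s * s) {{m*n≢0 s s}} c)

  s+2≤s*s : s + 2 ≤ s * s
  s+2≤s*s = ≤-trans (+-monoʳ-≤ s s>1) (≤-trans (≤-reflexive (cong (s +_) (sym (+-identityʳ s)))) (*-monoˡ-≤ s s>1))

  σ-suc : ∀ c → σ (suc c) ≡ s * s * σ c
  σ-suc c = swap t (s * s) ((s * s) ^ c)
    where
    swap : ∀ t r k → t * (r * k) ≡ r * (t * k)
    swap = solve-∀

  -- Each step multiplies σ by s², and s + 2 ≤ s² absorbs the two extra summands.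
  Q≤σ : ∀ c → Q c ≤ σ c
  Q≤σ zero    = z≤n
  Q≤σ (suc c) = begin
    1 + (s * Q c + σ c)     ≤⟨ +-mono-≤ (σ>0 c) (+-monoˡ-≤ (σ c) (*-monoʳ-≤ s (Q≤σ c))) ⟩
    σ c + (s * σ c + σ c)   ≡⟨ collect s (σ c) ⟩
    (s + 2) * σ c           ≤⟨ *-monoˡ-≤ (σ c) s+2≤s*s ⟩
    s * s * σ c             ≡⟨ sym (σ-suc c) ⟩
    σ (suc c)               ∎
    where
    open ≤-Reasoning
    collect : ∀ s k → k + (s * k + k) ≡ (s + 2) * k
    collect = solve-∀

  -- The same factor s + 1 bounds the growth of `br` from above in `br-suc`, which is what makes
  -- `br*Q` work.
  Q-suc : ∀ c → suc s * Q c ≤ Q (suc c)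
  Q-suc c = begin
    Q c + s * Q c       ≡⟨ +-comm (Q c) _ ⟩
    s * Q c + Q c       ≤⟨ +-monoʳ-≤ (s * Q c) (Q≤σ c) ⟩
    s * Q c + σ c       ≤⟨ n≤1+n _ ⟩
    Q (suc c)           ∎
    where open ≤-Reasoning

  br-suc : ∀ m → br (suc (suc m)) ≤ suc s * br (suc m)
  br-suc m = s≤s (+-monoˡ-≤ (s * br (suc m)) z≤n)

  br*Q : ∀ m c → br (suc (suc m)) * Q c ≤ br (suc m) * Q (suc c)
  br*Q m c = begin
    br (suc (suc m)) * Q c     ≤⟨ *-monoˡ-≤ (Q c) (br-suc m) ⟩
    suc s * br (suc m) * Q c   ≡⟨ swap (suc s) (br (suc m)) (Q c) ⟩
    br (suc m) * (suc s * Q c) ≤⟨ *-monoʳ-≤ (br (suc m)) (Q-suc c) ⟩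
    br (suc m) * Q (suc c)     ∎
    where
    open ≤-Reasoning
    swap : ∀ a b q → a * b * q ≡ b * (a * q)
    swap = solve-∀

  -- The product reaches the factor Q 0 = 0: a subspace of corank c has no perpendicular partner
  -- exceeding the meet by more than c dimensions.
  K-vanishes : ∀ d a c → c < d → K c a d ≡ 0
  K-vanishes (suc d) a zero    _         = cong (_* K 0 a d) (*-zeroʳ (s ^ a))
  K-vanishes (suc d) a (suc c) (s≤s c<d) =
    trans (cong (s ^ a * Q (suc c) *_) (K-vanishes d a c c<d)) (*-zeroʳ (s ^ a * Q (suc c)))

  -- Factor by factor, `br*Q` trades one step of rank for one step of corank; d ≤ m keeps the `br`
  -- factors positive.
  falling*K-mono : ∀ d a m c → d ≤ m → falling (suc m) d * K c a d ≤ falling m d * K (suc c) a d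
  falling*K-mono zero    a m       c       _         = ≤-refl
  falling*K-mono (suc d) a (suc m) zero    (s≤s d≤m) = ≤-trans (≤-reflexive (trans
    (cong (falling (suc (suc m)) (suc d) *_) (K-vanishes (suc d) a 0 (s≤s z≤n)))
    (*-zeroʳ (falling (suc (suc m)) (suc d))))) z≤n
  falling*K-mono (suc d) a (suc m) (suc c) (s≤s d≤m) = begin
    br (suc (suc m)) * falling (suc m) d * (s ^ a * Q (suc c) * K c a d)
      ≡⟨ regroup (br (suc (suc m))) (falling (suc m) d) (s ^ a) (Q (suc c)) (K c a d) ⟩
    s ^ a * (br (suc (suc m)) * Q (suc c)) * (falling (suc m) d * K c a d)
      ≤⟨ *-mono-≤ (*-monoʳ-≤ (s ^ a) (br*Q m (suc c))) (falling*K-mono d a m c d≤m) ⟩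
    s ^ a * (br (suc m) * Q (suc (suc c))) * (falling m d * K (suc c) a d)
      ≡⟨ sym (regroup (br (suc m)) (falling m d) (s ^ a) (Q (suc (suc c))) (K (suc c) a d)) ⟩
    br (suc m) * falling m d * (s ^ a * Q (suc (suc c)) * K (suc c) a d) ∎
    where
    open ≤-Reasoning
    regroup : ∀ b f x q k → b * f * (x * q * k) ≡ x * (b * q) * (f * k)
    regroup = solve-∀

  K>0 : ∀ d a c → d ≤ c → 0 < K c a d
  K>0 zero    a c       _         = s≤s z≤n
  K>0 (suc d) a (suc c) (s≤s d≤c) = *-mono-≤ (*-mono-≤ (m^n>0 s a) (s≤s z≤n)) (K>0 d a c d≤c)

  falling>0 : ∀ d e → d ≤ e → 0 < falling e d
  falling>0 zero    e       _         = s≤s z≤n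
  falling>0 (suc d) (suc e) (s≤s d≤e) = *-mono-≤ {1} {br (suc e)} (s≤s z≤n) (falling>0 d e d≤e)

  -- The comparison of A_k with A_(k+1) lengthens the products at the far end, whereas the
  -- definitions recurse at the near end.
  falling-last : ∀ d e → falling e (suc d) ≡ falling e d * br (e ∸ d)
  falling-last zero    e = trans (*-identityʳ (br e)) (sym (+-identityʳ (br e)))
  falling-last (suc d) e = begin
    br e * falling (e ∸ 1) (suc d)           ≡⟨ cong (br e *_) (falling-last d (e ∸ 1)) ⟩
    br e * (falling (e ∸ 1) d * br (e ∸ 1 ∸ d)) ≡⟨ cong (λ z → br e * (falling (e ∸ 1) d * br z)) (∸-+-assoc e 1 d) ⟩
    br e * (falling (e ∸ 1) d * br (e ∸ suc d)) ≡⟨ sym (*-assoc (br e) _ _) ⟩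
    falling e (suc d) * br (e ∸ suc d)       ∎
    where open ≡-Reasoning

  K-last : ∀ d a c → K c a (suc d) ≡ K c a d * (s ^ a * Q (c ∸ d))
  K-last zero    a c = trans (*-identityʳ _) (sym (+-identityʳ _))
  K-last (suc d) a c = begin
    s ^ a * Q c * K (c ∸ 1) a (suc d) ≡⟨ cong (s ^ a * Q c *_) (K-last d a (c ∸ 1)) ⟩
    s ^ a * Q c * (K (c ∸ 1) a d * (s ^ a * Q (c ∸ 1 ∸ d)))
      ≡⟨ cong (λ z → s ^ a * Q c * (K (c ∸ 1) a d * (s ^ a * Q z))) (∸-+-assoc c 1 d) ⟩
    s ^ a * Q c * (K (c ∸ 1) a d * (s ^ a * Q (c ∸ suc d))) ≡⟨ sym (*-assoc (s ^ a * Q c) _ _) ⟩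
    K c a (suc d) * (s ^ a * Q (c ∸ suc d)) ∎
    where open ≡-Reasoning

  K-exponent : ∀ d a c → K c (suc a) d ≡ s ^ d * K c a d
  K-exponent zero    a c = refl
  K-exponent (suc d) a c = trans (cong (s ^ suc a * Q c *_) (K-exponent d a (c ∸ 1)))
    (regroup s (s ^ a) (Q c) (s ^ d) (K (c ∸ 1) a d))
    where
    regroup : ∀ s x q y k → s * x * q * (y * k) ≡ s * y * (x * q * k)
    regroup = solve-∀

  -- The extra 1 strengthens [k+1] < 2 s^k so that the induction closes, using 2 ≤ s.
  br<2s^ : ∀ k → br (suc k) + 1 ≤ 2 * s ^ k
  br<2s^ zero    = ≤-reflexive (cong (_+ 1) br1)
  br<2s^ (suc k) = begin
    suc (s * br (suc k)) + 1   ≡⟨ cong suc (+-comm _ 1) ⟩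
    2 + s * br (suc k)         ≤⟨ +-monoˡ-≤ (s * br (suc k)) s>1 ⟩
    s + s * br (suc k)         ≡⟨ collect s (br (suc k)) ⟩
    s * (br (suc k) + 1)       ≤⟨ *-monoʳ-≤ s (br<2s^ k) ⟩
    s * (2 * s ^ k)            ≡⟨ swap s (s ^ k) ⟩
    2 * s ^ suc k              ∎
    where
    open ≤-Reasoning
    collect : ∀ s b → s + s * b ≡ s * (b + 1)
    collect = solve-∀
    swap : ∀ s x → s * (2 * x) ≡ 2 * (s * x)
    swap = solve-∀

  -- [k+1]² is the additional denominator in passing from A_k to A_(k+1); on the right stand the
  -- additional power of s and the lower bound 2 for Q 1 = t + 1.
  br²< : ∀ k → br (suc k) * br (suc k) < s ^ k * s ^ suc k * 2
  br²< k = begin-strict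
    br (suc k) * br (suc k)       <⟨ *-mono-< lt lt ⟩
    2 * s ^ k * (2 * s ^ k)       ≡⟨ swap (s ^ k) ⟩
    2 * (s ^ k * s ^ k * 2)       ≤⟨ *-monoˡ-≤ (s ^ k * s ^ k * 2) s>1 ⟩
    s * (s ^ k * s ^ k * 2)       ≡⟨ swap' s (s ^ k) ⟩
    s ^ k * s ^ suc k * 2         ∎
    where
    open ≤-Reasoning
    lt : br (suc k) < 2 * s ^ k
    lt = subst (_≤ 2 * s ^ k) (+-comm _ 1) (br<2s^ k)
    swap : ∀ x → 2 * x * (2 * x) ≡ 2 * (x * x * 2)
    swap = solve-∀
    swap' : ∀ s x → s * (x * x * 2) ≡ x * (s * x) * 2
    swap' = solve-∀

  -- Classes by codimension of the meet, compared for consecutive ranks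

  sumTo : (ℕ → ℕ) → ℕ → ℕ
  sumTo f zero    = 0
  sumTo f (suc c) = f c + sumTo f c

  sumTo-cong : ∀ {f g} c → (∀ a → a < c → f a ≡ g a) → sumTo f c ≡ sumTo g c
  sumTo-cong zero    h = refl
  sumTo-cong (suc c) h = cong₂ _+_ (h c ≤-refl) (sumTo-cong c (λ a a<c → h a (m<n⇒m<1+n a<c)))

  sumTo-mono : ∀ {f g} c → (∀ a → a < c → f a ≤ g a) → sumTo f c ≤ sumTo g c
  sumTo-mono zero    h = z≤n
  sumTo-mono (suc c) h = +-mono-≤ (h c ≤-refl) (sumTo-mono c (λ a a<c → h a (m<n⇒m<1+n a<c)))

  sumTo-strict : ∀ {f g} c → (∀ a → a < c → f a ≤ g a) → ∀ a₀ → a₀ < c → f a₀ < g a₀ → sumTo f c < sumTo g c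
  sumTo-strict (suc c) h a₀ (s≤s a₀≤c) lt with m≤n⇒m<n∨m≡n a₀≤c
  ... | inj₁ a₀<c = +-mono-≤-< (h c ≤-refl) (sumTo-strict c (λ a a<c → h a (m<n⇒m<1+n a<c)) a₀ a₀<c lt)
  ... | inj₂ refl = +-mono-<-≤ lt (sumTo-mono c (λ a a<c → h a (m<n⇒m<1+n a<c)))

  #-partition : ∀ c (P : DecPred Sb) (cls : ℕ → DecPred Sb) →
    (∀ Y → Holds P Y → ∃ λ a → a < c × Holds (cls a) Y) →
    (∀ Y a b → a < c → b < c → Holds (cls a) Y → Holds (cls b) Y → a ≡ b) →
    # P ≡ sumTo (λ a → # (P ∧ cls a)) c
  #-partition zero    P cls cover disjoint = #-empty P (λ { Y pY → case proj₁ (proj₂ (cover Y pY)) of λ () })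
  #-partition (suc c) P cls cover disjoint = trans (#-split P (cls c)) (cong (# (P ∧ cls c) +_) (trans
    (#-partition c (P ∧ ∁ (cls c)) cls cover'
      (λ Y a b a<c b<c → disjoint Y a b (m<n⇒m<1+n a<c) (m<n⇒m<1+n b<c)))
    (sumTo-cong c (λ a a<c → #-cong ((P ∧ ∁ (cls c)) ∧ cls a) (P ∧ cls a)
      (λ { Y ((pY , _) , cY) → pY , cY })
      (λ { Y (pY , cY) → (pY , λ cY' → <⇒≢ a<c (disjoint Y a c (m<n⇒m<1+n a<c) ≤-refl cY cY')) , cY })))))
    where
    cover' : ∀ Y → Holds (P ∧ ∁ (cls c)) Y → ∃ λ a → a < c × Holds (cls a) Y
    cover' Y (pY , ¬cY) =
      let a , a<1+c , cY = cover Y pY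
      in a , ≤∧≢⇒< (s≤s⁻¹ a<1+c) (λ e → ¬cY (subst (λ a → Holds (cls a) Y) e cY)) , cY

  -- The number A_a(k) of the overview, for X of rank m = n - k and a ≤ m.
  perpClass : ℕ → Sb → ℕ → ℕ
  perpClass m X a = # (Stratum X m (m ∸ a))

  #-perp : ∀ {m X} → Rk m X → # (Rank m ∧ PerpTo X) ≡ sumTo (perpClass m X) (suc m)
  #-perp {m} {X} rX = #-partition (suc m) (Rank m ∧ PerpTo X) (λ a → MeetRank X (m ∸ a)) cover
    (λ Y a b a≤m b≤m ra rb → ∸-cancelˡ-≡ (s≤s⁻¹ a≤m) (s≤s⁻¹ b≤m) (rank-unique ra rb))
    where
    cover : ∀ Y → Holds (Rank m ∧ PerpTo X) Y → ∃ λ a → a < suc m × Rk (m ∸ a) (Y ∩ X)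
    cover Y (rY , _) =
      let b , rM = rankOf (∩-singular (singular rY) (singular rX))
          b≤m = rank-⊆ (p∩q⊆q Y X) rM rX
      in m ∸ b , s≤s (m∸n≤m m b) , cast (sym (m∸[m∸n]≡n b≤m)) rM

  perpClass-formula : ∀ a {m k X} → m + k ≡ n → Rk m X → a ≤ m →
    perpClass m X a * (fac a * fac a) ≡ falling m a * K k a a
  perpClass-formula a {m} {k} {X} eq rX a≤m = subst
    (λ z → # (Stratum X z (m ∸ a)) * (fac a * fac a) ≡ falling z a * K k a a) e
    (#-stratum (m ∸ a) a k (trans (cong (_+ k) e) eq) (cast (sym e) rX))
    where
    e : m ∸ a + a ≡ m
    e = m∸n+n≡m a≤m

  fac²-nonZero : ∀ a → NonZero (fac a * fac a)
  fac²-nonZero a = m*n≢0 (fac a) (fac a) {{fac-nonZero a}} {{fac-nonZero a}}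

  perpClass-vanishes : ∀ a {m k X} → m + k ≡ n → Rk m X → a ≤ m → k < a → perpClass m X a ≡ 0
  perpClass-vanishes a {m} {k} {X} eq rX a≤m k<a = *-cancelʳ-≡ _ _ (fac a * fac a) {{fac²-nonZero a}}
    (trans (perpClass-formula a eq rX a≤m) (trans (cong (falling m a *_) (K-vanishes a a k k<a)) (*-zeroʳ (falling m a))))

  perpClass>0 : ∀ a {m k X} → m + k ≡ n → Rk m X → a ≤ m → a ≤ k → 0 < perpClass m X a
  perpClass>0 a {m} {k} {X} eq rX a≤m a≤k = n≢0⇒n>0 (λ z → <⇒≢
    (*-mono-≤ (falling>0 a m a≤m) (K>0 a a k a≤k))
    (trans (sym (cong (_* (fac a * fac a)) z)) (perpClass-formula a eq rX a≤m)))

  perpClass-mono : ∀ a {m k X X'} → suc m + k ≡ n → Rk (suc m) X → Rk m X' → a ≤ m →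
    perpClass (suc m) X a ≤ perpClass m X' a
  perpClass-mono a {m} {k} {X} {X'} eq rX rX' a≤m =
    *-cancelʳ-≤ _ _ (fac a * fac a) {{fac²-nonZero a}} (begin
      perpClass (suc m) X a * (fac a * fac a) ≡⟨ perpClass-formula a eq rX (m≤n⇒m≤1+n a≤m) ⟩
      falling (suc m) a * K k a a             ≤⟨ falling*K-mono a a m k a≤m ⟩
      falling m a * K (suc k) a a             ≡⟨ sym (perpClass-formula a (trans (+-suc m k) eq) rX' a≤m) ⟩
      perpClass m X' a * (fac a * fac a)      ∎)
    where open ≤-Reasoning

  -- The sums have different lengths; the extra class a = m + 1 on the left is empty because k < m +
  -- 1. Strictness is won at a = k + 1, where the product of Q factors reaches Q 0 on the left but
  -- not on the right.
  perp-decreasing : ∀ {m k X X'} → suc m + k ≡ n → suc k ≤ m → Rk (suc m) X → Rk m X' →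
    # (Rank (suc m) ∧ PerpTo X) < # (Rank m ∧ PerpTo X')
  perp-decreasing {m} {k} {X} {X'} eq k<m rX rX' = subst₂ _<_
    (trans (sym (cong (_+ sumTo (perpClass (suc m) X) (suc m))
      (perpClass-vanishes (suc m) eq rX ≤-refl (m<n⇒m<1+n k<m)))) (sym (#-perp rX)))
    (sym (#-perp rX'))
    (sumTo-strict (suc m) (λ a a≤m → perpClass-mono a eq rX rX' (s≤s⁻¹ a≤m)) (suc k) (s≤s k<m)
      (subst (_< perpClass m X' (suc k)) (sym (perpClass-vanishes (suc k) eq rX (m≤n⇒m≤1+n k<m) ≤-refl))
        (perpClass>0 (suc k) (trans (+-suc m k) eq) rX' k<m ≤-refl)))

  -- The class a = k consists of the Y spanning a maximal singular subspace with X.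
  perpMax-decreasing : ∀ {m k X X'} → suc m + k ≡ n → suc k ≤ m → Rk (suc m) X → Rk m X' →
    perpClass (suc m) X k < perpClass m X' (suc k)
  perpMax-decreasing {m} {k} {X} {X'} eq k<m rX rX' =
    *-cancelʳ-< (F * F * (B * B)) _ _ (begin-strict
      perpClass (suc m) X k * (F * F * (B * B))     ≡⟨ sym (*-assoc (perpClass (suc m) X k) (F * F) (B * B)) ⟩
      perpClass (suc m) X k * (F * F) * (B * B)     ≡⟨ cong (_* (B * B)) (perpClass-formula k eq rX (m≤n⇒m≤1+n k≤m)) ⟩
      falling (suc m) k * K k k k * (B * B)         ≤⟨ *-monoˡ-≤ (B * B) (falling*K-mono k k m k k≤m) ⟩
      -- The preceding step worked at fixed a = k. Passing to a = k + 1 multiplies the numerator by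
      -- s^k for the old Q factors, by s^(k+1) Q 1 for the new one and by [m-k], against the new
      -- denominator [k+1]².
      T * (B * B)                                   <⟨ *-monoʳ-< T {{>-nonZero T>0}} (<-≤-trans (br²< k) bound) ⟩
      T * (s ^ k * s ^ suc k * (Q 1 * br (m ∸ k)))  ≡⟨ regroup (falling m k) (K (suc k) k k) (s ^ k) (s ^ suc k) (Q 1) (br (m ∸ k)) ⟩
      falling m k * br (m ∸ k) * (s ^ k * K (suc k) k k * (s ^ suc k * Q 1))
        ≡⟨ sym (cong₂ _*_ (falling-last k m) (trans (K-last k (suc k) (suc k))
             (cong₂ _*_ (K-exponent k k (suc k)) (cong (λ z → s ^ suc k * Q z) (m+n∸n≡m 1 k))))) ⟩
      falling m (suc k) * K (suc k) (suc k) (suc k) ≡⟨ sym (perpClass-formula (suc k) (trans (+-suc m k) eq) rX' k<m) ⟩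
      perpClass m X' (suc k) * (B * F * (B * F))    ≡⟨ cong (perpClass m X' (suc k) *_) (square B F) ⟩
      perpClass m X' (suc k) * (F * F * (B * B))    ∎)
    where
    open ≤-Reasoning
    F B T : ℕ
    F = fac k
    B = br (suc k)
    T = falling m k * K (suc k) k k
    k≤m : k ≤ m
    k≤m = <⇒≤ k<m
    T>0 : 0 < T
    T>0 = *-mono-≤ (falling>0 k m k≤m) (K>0 k k (suc k) (n≤1+n k))
    2≤Q1 : 2 ≤ Q 1
    2≤Q1 = s≤s (≤-trans (σ>0 0) (m≤n+m (σ 0) (s * Q 0)))
    bound : s ^ k * s ^ suc k * 2 ≤ s ^ k * s ^ suc k * (Q 1 * br (m ∸ k))
    bound = *-monoʳ-≤ (s ^ k * s ^ suc k) (*-mono-≤ 2≤Q1 (br-< (m<n⇒0<n∸m k<m)))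
    regroup : ∀ f k a b q c → f * k * (a * b * (q * c)) ≡ f * c * (a * k * (b * q))
    regroup = solve-∀
    square : ∀ b f → b * f * (b * f) ≡ f * f * (b * b)
    square = solve-∀

  -- Valencies and isomorphisms

  degree : (ℕ → Sb → DecPred Sb) → ℕ → Sb → ℕ
  degree Rel m X = # ((Rank m ∧ Rel m X) ∧ ∁ (is X))

  -- The two numerical hypotheses amount to k = n - m - 1 and n ≤ 2m.
  Decreasing : (ℕ → Sb → DecPred Sb) → Set
  Decreasing Rel = ∀ {m k X X'} → suc m + k ≡ n → suc k ≤ m → Rk (suc m) X → Rk m X' →
    degree Rel (suc m) X < degree Rel m X'

  -- `step` compares arbitrary subspaces of consecutive ranks, so any subspace of rank b inside X
  -- can link X to X'. The bound n ≤ 2a passes on to all higher ranks.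
  degree-decreasing : ∀ {Rel} → Decreasing Rel → ∀ {a} b {X X'} → n ≤ a + a → a < b → b ≤ n →
    Rk b X → Rk a X' → degree Rel b X < degree Rel a X'
  degree-decreasing {Rel} step {a} (suc b) {X} {X'} n≤2a (s≤s a≤b) b<n rX rX' with m≤n⇒m<n∨m≡n a≤b
  ... | inj₂ refl = step (m+[n∸m]≡n b<n) (small (m+[n∸m]≡n b<n)) rX rX'
    where
    small : ∀ {k} → suc a + k ≡ n → suc k ≤ a
    small {k} eq = +-cancelˡ-≤ a _ _ (≤-trans (≤-reflexive (trans (+-suc a k) eq)) n≤2a)
  ... | inj₁ a<b =
    let X'' , _ , rX'' = rank-sub rX b (n≤1+n b)
    in <-trans (step (m+[n∸m]≡n b<n) (small (m+[n∸m]≡n b<n)) rX rX'')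
         (degree-decreasing {Rel} step b n≤2a a<b (<⇒≤ b<n) rX'' rX')
    where
    small : ∀ {k} → suc b + k ≡ n → suc k ≤ b
    small {k} eq = +-cancelˡ-≤ b _ _ (≤-trans (≤-reflexive (trans (+-suc b k) eq)) (≤-trans n≤2a (+-mono-≤ a≤b a≤b)))

  -- The relations of the statement come without decision procedures, and the third involves a span;
  -- counting uses decidable relations that agree with them on subspaces of rank m.
  Represents : (ℕ → Sb → DecPred Sb) → ℕ → (Sb → Sb → Set) → Set
  Represents Rel m R = ∀ {X Y} → Rk m X → Rk m Y → R X Y ⇔ Holds (Rel m X) Y

  n≤twice : ∀ {i} → n ∸ 2 ≤ 2 * i → n ≤ suc i + suc i
  n≤twice {i} n∸2≤2i = subst₂ _≤_ (m+[n∸m]≡n (<⇒≤ 3≤n)) (double i) (+-monoʳ-≤ 2 n∸2≤2i)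
    where
    double : ∀ i → 2 + 2 * i ≡ suc i + suc i
    double = solve-∀

  rank≤ : ∀ {j} → j ≤ n ∸ 1 → suc j ≤ n
  rank≤ {j} j≤n∸1 = subst (suc j ≤_) 1+n∸1 (s≤s j≤n∸1)

  -- An isomorphism matches the neighbours of g X with those of X, so the two degrees agree,
  -- contrary to `degree-decreasing`.
  not-isomorphic : ∀ Rel → Decreasing Rel → ∀ {i j R₁ R₂} → n ∸ 2 ≤ 2 * i → i < j → j ≤ n ∸ 1 →
    Represents Rel (suc i) R₁ → Represents Rel (suc j) R₂ → ¬ Iso (Δ G i) (Adj R₁) (Δ G j) (Adj R₂)
  not-isomorphic Rel step {i} {j} {R₁} {R₂} n∸2≤2i i<j j≤n∸1 rep₁ rep₂ (f , g , fV , gV , gf , fg , adj) =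
    <-irrefl (sym same) (degree-decreasing {Rel} step (suc j) (n≤twice n∸2≤2i) (s≤s i<j) j<n rX rX')
    where
    j<n : suc j ≤ n
    j<n = rank≤ j≤n∸1
    start : ∃ λ X → X ⊆ proj₁ someMaximal × Rk (suc j) X
    start = rank-sub (proj₂ someMaximal) (suc j) j<n
    X X' : Sb
    X = proj₁ start
    X' = g X
    rX : Rk (suc j) X
    rX = proj₂ (proj₂ start)
    ΔX' : Δ G i X'
    ΔX' = gV X (rank⇒Δ rX)
    rX' : Rk (suc i) X'
    rX' = Δ⇒rank ΔX'
    fX' : f X' ≡ X
    fX' = fg X (rank⇒Δ rX)
    to : ∀ Y → Holds ((Rank (suc i) ∧ Rel (suc i) X') ∧ ∁ (is X')) Y →
         Holds ((Rank (suc j) ∧ Rel (suc j) X) ∧ ∁ (is X)) (f Y)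
    to Y ((rY , r) , Y≢X') =
      let rfY = Δ⇒rank (fV Y (rank⇒Δ rY))
          X≢fY , r' = subst (λ Z → Adj R₂ Z (f Y)) fX'
            (proj₁ (adj X' Y ΔX' (rank⇒Δ rY)) ((λ e → Y≢X' (sym e)) , proj₂ (rep₁ rX' rY) r))
      in (rfY , proj₁ (rep₂ rX rfY) r') , λ e → X≢fY (sym e)
    from : ∀ Y → Holds ((Rank (suc j) ∧ Rel (suc j) X) ∧ ∁ (is X)) Y →
           Holds ((Rank (suc i) ∧ Rel (suc i) X') ∧ ∁ (is X')) (g Y)
    from Y ((rY , r) , Y≢X) =
      let ΔgY = gV Y (rank⇒Δ rY)
          X'≢gY , r' = proj₂ (adj X' (g Y) ΔX' ΔgY) (subst₂ (Adj R₂) (sym fX') (sym (fg Y (rank⇒Δ rY)))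
            ((λ e → Y≢X (sym e)) , proj₂ (rep₂ rX rY) r))
      in (Δ⇒rank ΔgY , proj₁ (rep₁ rX' (Δ⇒rank ΔgY)) r') , λ e → X'≢gY (sym e)
    same : degree Rel (suc i) X' ≡ degree Rel (suc j) X
    same = #-bijection _ _ f g to from
      (λ Y h → gf Y (rank⇒Δ (proj₁ (proj₁ h)))) (λ Y h → fg Y (rank⇒Δ (proj₁ (proj₁ h))))

  -- The three adjacency relations

  degree-suc : ∀ Rel {m X} → Rk m X → Holds (Rel m X) X → # (Rank m ∧ Rel m X) ≡ suc (degree Rel m X)
  degree-suc Rel {m} {X} rX rel = trans (#-relative (Rank m ∧ Rel m X) (is X) (λ { _ refl → rX , rel }))
    (cong (_+ degree Rel m X) (#-is X))

  perp-refl : ∀ {X} → Singular G X → Perp G X X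
  perp-refl sX = proj₁ sX

  -- Perpendicular X and Y of rank m whose meet has rank b span a subspace of rank 2m - b. This is n
  -- exactly when b = 2m - n, written m ∸ (n ∸ m).
  PerpRel ApproxRel PerpMaxRel : ℕ → Sb → DecPred Sb
  PerpRel m X = PerpTo X
  ApproxRel m X = PerpTo X ∨ MeetRank X (m ∸ 1)
  PerpMaxRel m X = PerpTo X ∧ MeetRank X (m ∸ (n ∸ m))

  PerpRel-decreasing : Decreasing PerpRel
  PerpRel-decreasing eq k<m rX rX' = s≤s⁻¹ (subst₂ _<_
    (degree-suc PerpRel rX (perp-refl (singular rX))) (degree-suc PerpRel rX' (perp-refl (singular rX')))
    (perp-decreasing eq k<m rX rX'))

  #-approx : ∀ b X → # (Rank (suc b) ∧ ApproxRel (suc b) X) ≡ # (Rank (suc b) ∧ PerpTo X) + # (ApproxNonPerp X b)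
  #-approx b X = trans (#-split (Rank (suc b) ∧ ApproxRel (suc b) X) (PerpTo X)) (cong₂ _+_
    (#-cong _ (Rank (suc b) ∧ PerpTo X) (λ { Y ((rY , _) , XY) → rY , XY }) (λ { Y (rY , XY) → (rY , inj₁ XY) , XY }))
    (#-cong _ (ApproxNonPerp X b)
      (λ { Y ((rY , inj₁ XY) , ¬XY) → ⊥-elim (¬XY XY) ; Y ((rY , inj₂ rM) , ¬XY) → (rY , rM) , ¬XY })
      (λ { Y ((rY , rM) , ¬XY) → (rY , inj₂ rM) , ¬XY })))

  -- When the corank grows by one, σ gains the factor s², while the lower rank costs `br` at most
  -- the factor s + 1.
  approxNonPerp-decreasing : ∀ m k {X X'} → suc (suc m) + k ≡ n → Rk (suc (suc m)) X → Rk (suc m) X' →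
    # (ApproxNonPerp X (suc m)) ≤ # (ApproxNonPerp X' m)
  approxNonPerp-decreasing m k {X} {X'} eq rX rX' = begin
    # (ApproxNonPerp X (suc m))   ≡⟨ #-approxNonPerp (suc m) k eq rX ⟩
    br (suc (suc m)) * σ k        ≤⟨ *-monoˡ-≤ (σ k) (≤-trans (br-suc m) (*-monoˡ-≤ (br (suc m)) 1+s≤s*s)) ⟩
    s * s * br (suc m) * σ k      ≡⟨ swap (s * s) (br (suc m)) (σ k) ⟩
    br (suc m) * (s * s * σ k)    ≡⟨ cong (br (suc m) *_) (sym (σ-suc k)) ⟩
    br (suc m) * σ (suc k)        ≡⟨ sym (#-approxNonPerp m (suc k) (trans (+-suc (suc m) k) eq) rX') ⟩
    # (ApproxNonPerp X' m)        ∎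
    where
    open ≤-Reasoning
    1+s≤s*s : suc s ≤ s * s
    1+s≤s*s = ≤-trans (≤-trans (≤-reflexive (+-comm 1 s)) (+-monoʳ-≤ s (s≤s z≤n))) s+2≤s*s
    swap : ∀ a b c → a * b * c ≡ b * (a * c)
    swap = solve-∀

  ApproxRel-decreasing : Decreasing ApproxRel
  ApproxRel-decreasing {suc m} {k} {X} {X'} eq k<m rX rX' = s≤s⁻¹ (subst₂ _<_
    (trans (sym (#-approx (suc m) X)) (degree-suc ApproxRel rX (inj₁ (perp-refl (singular rX)))))
    (trans (sym (#-approx m X')) (degree-suc ApproxRel rX' (inj₁ (perp-refl (singular rX')))))
    (+-mono-<-≤ (perp-decreasing eq k<m rX rX') (approxNonPerp-decreasing m k eq rX rX')))

  corank : ∀ {m k} → m + k ≡ n → n ∸ m ≡ k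
  corank {m} {k} refl = m+n∸m≡n m k

  -- Inclusions suffice: the class of the higher rank is taken without removing X, and the class of
  -- the lower rank cannot contain X' because its meets have codimension k + 1 > 0.
  PerpMaxRel-decreasing : Decreasing PerpMaxRel
  PerpMaxRel-decreasing {m} {k} {X} {X'} eq k<m rX rX' = begin-strict
    degree PerpMaxRel (suc m) X
      ≤⟨ #-mono _ (Stratum X (suc m) (suc m ∸ k)) (λ { Y ((rY , XY , rM) , _) →
           (rY , XY) , cast (cong (suc m ∸_) (corank {suc m} {k} eq)) rM }) ⟩
    perpClass (suc m) X k       <⟨ perpMax-decreasing eq k<m rX rX' ⟩
    perpClass m X' (suc k)
      ≤⟨ #-mono (Stratum X' m (m ∸ suc k)) _ (λ { Y ((rY , XY) , rM) →
           (rY , XY , cast (cong (m ∸_) (sym (corank {m} {suc k} eq'))) rM) , λ { refl → proper rM } }) ⟩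
    degree PerpMaxRel m X'      ∎
    where
    open ≤-Reasoning
    eq' : m + suc k ≡ n
    eq' = trans (+-suc m k) eq
    proper : ¬ Rk (m ∸ suc k) (X' ∩ X')
    proper rM = <-irrefl (rank-unique (subst (Rk (m ∸ suc k)) (∩-idem X') rM) rX')
      (∸-monoʳ-< {m} (s≤s z≤n) k<m)

  -- Points of Y are absorbed into X one at a time. By `join-meet` each step raises the ranks of X
  -- and of the meet by one, and d is the codimension of the meet in Y.
  span : ∀ d {x z X Y} → Perp G X Y → Rk x X → Rk (z + d) Y → Rk z (Y ∩ X) →
    ∃ λ W → Rk (x + d) W × Span G X Y W
  span zero {x} {z} {X} {Y} XY rX rY rM = X , cast (sym (+-identityʳ x)) rX , singular rX , ∪⊆ ,
    λ W sW X∪Y⊆W x∈ → X∪Y⊆W (x∈p∪q⁺ (inj₁ x∈))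
    where
    Y≡ : Y ∩ X ≡ Y
    Y≡ = rank-≡ (p∩q⊆p Y X) rM (cast (+-identityʳ z) rY)
    ∪⊆ : X ∪ Y ⊆ X
    ∪⊆ x∈ with x∈p∪q⁻ X Y x∈
    ... | inj₁ x∈X = x∈X
    ... | inj₂ x∈Y = p∩q⊆q Y X (subst (_ ∈_) (sym Y≡) x∈Y)
  span (suc d) {x} {z} {X} {Y} XY rX rY rM =
    let y , y∈Y , y∉M = pointOutside rM rY (m<m+n z (s≤s z≤n))
        yX  = perp⇒⊥ˢ XY y∈Y
        y∉X = λ y∈X → y∉M (x∈p∩q⁺ (y∈Y , y∈X))
        W , rW , sW , JY⊆W , least = span d {X = J X y}
          (⊥ˢ⇒perp (λ b∈ → ⊥ˢ-J y∉X (perp⇒⊥ˢ XY b∈) (singular⇒⊥ˢ (singular rY) b∈ y y∈Y)))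
          (J-rank rX yX y∉X) (cast (+-suc z d) rY)
          (subst (Rk (suc z)) (sym (join-meet (singular rY) (p∩q⊆q Y X) yX y∉X refl y∈Y))
            (J-rank rM (⊥ˢ-⊆ (p∩q⊆q Y X) yX) y∉M))
    in W , cast (sym (+-suc x d)) rW , sW ,
       ∪-least (λ x∈ → JY⊆W (x∈p∪q⁺ (inj₁ (X⊆J yX x∈)))) (λ x∈ → JY⊆W (x∈p∪q⁺ (inj₂ x∈))) ,
       λ V sV X∪Y⊆V → least V sV (∪-least
         (J⊆ sV y∉X (λ x∈ → X∪Y⊆V (x∈p∪q⁺ (inj₁ x∈))) (X∪Y⊆V (x∈p∪q⁺ (inj₂ y∈Y))))
         (λ x∈ → X∪Y⊆V (x∈p∪q⁺ (inj₂ x∈))))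
    where
    ∪-least : ∀ {A B C : Sb} → A ⊆ C → B ⊆ C → A ∪ B ⊆ C
    ∪-least {A} {B} A⊆C B⊆C x∈ with x∈p∪q⁻ A B x∈
    ... | inj₁ a = A⊆C a
    ... | inj₂ b = B⊆C b

  PerpRel-represents : ∀ m → Represents PerpRel m (Perp G)
  PerpRel-represents m _ _ = (λ XY → XY) , (λ XY → XY)

  -- At i = 0 truncated subtraction would make `Approx` ask for a meet of rank 1 and `MeetRank` for
  -- one of rank 0, hence 0 < i.
  ApproxRel-represents : ∀ i → 0 < i → Represents ApproxRel (suc i) (λ X Y → Perp G X Y ⊎ Approx G i X Y)
  ApproxRel-represents (suc i) _ {X} {Y} _ _ =
    (λ { (inj₁ XY) → inj₁ XY ; (inj₂ d) → inj₂ (subst (Rk (suc i)) (∩-comm X Y) (dim⇒rank d)) }) ,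
    (λ { (inj₁ XY) → inj₁ XY ; (inj₂ r) → inj₂ (rank⇒dim (subst (Rk (suc i)) (∩-comm Y X) r)) })

  -- Spans are unique, so the given Z is the W built by `span`, and comparing ranks determines the
  -- meet. The bound n ≤ 2m makes 2m - n an honest difference.
  PerpMaxRel-represents : ∀ {m} → n ≤ m + m → m ≤ n → Represents PerpMaxRel m (PerpMax G n)
  PerpMaxRel-represents {m} n≤2m m≤n {X} {Y} rX rY = to , from
    where
    k : ℕ
    k = n ∸ m
    m+k≡n : m + k ≡ n
    m+k≡n = m+[n∸m]≡n m≤n
    k≤m : k ≤ m
    k≤m = +-cancelˡ-≤ m _ _ (subst (_≤ m + m) (sym m+k≡n) n≤2m)
    to : PerpMax G n X Y → Holds (PerpMaxRel m X) Y
    to (XY , Z , (sZ , XY⊆Z , leastZ) , dZ) =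
      let b , rM = rankOf (∩-singular (singular rY) (singular rX))
          b≤m = rank-⊆ (p∩q⊆q Y X) rM rX
          d = m ∸ b
          W , rW , sW , XY⊆W , leastW = span d XY rX (cast (sym (m+[n∸m]≡n b≤m)) rY) rM
          W≡Z = ⊆-antisym (leastW Z sZ XY⊆Z) (leastZ W sW XY⊆W)
          rZ = cast 1+n∸1 (dim⇒rank dZ)
          d≡k = +-cancelˡ-≡ m d k (trans (rank-unique (subst (Rk (m + d)) W≡Z rW) rZ) (sym m+k≡n))
      in XY , cast (trans (sym (m∸[m∸n]≡n b≤m)) (cong (m ∸_) d≡k)) rM
    from : Holds (PerpMaxRel m X) Y → PerpMax G n X Y
    from (XY , rM) =
      let W , rW , sp = span k XY rX (cast (sym (m∸n+n≡m k≤m)) rY) rM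
      in XY , W , sp , rank⇒dim (cast (trans m+k≡n (sym 1+n∸1)) rW)

theorem1p9 : (G : Geometry) (n s t : ℕ) → 3 ≤ n → IsPolarSpaceOfOrder G n s t →
    (i j : ℕ) → n ∸ 2 ≤ 2 * i → i < j → j ≤ n ∸ 1 →
    ¬ Iso (Δ G i) (Adj (Perp G)) (Δ G j) (Adj (Perp G)) ×
    ¬ Iso (Δ G i) (Adj (λ X Y → Perp G X Y ⊎ Approx G i X Y))
    (Δ G j) (Adj (λ X Y → Perp G X Y ⊎ Approx G j X Y)) ×
    ¬ Iso (Δ G i) (Adj (PerpMax G n)) (Δ G j) (Adj (PerpMax G n))
theorem1p9 G n s t 3≤n ps i j n∸2≤2i i<j j≤n∸1 =
  not-isomorphic PerpRel PerpRel-decreasing n∸2≤2i i<j j≤n∸1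
    (PerpRel-represents (suc i)) (PerpRel-represents (suc j)) ,
  not-isomorphic ApproxRel ApproxRel-decreasing n∸2≤2i i<j j≤n∸1
    (ApproxRel-represents i i>0) (ApproxRel-represents j (<-trans i>0 i<j)) ,
  not-isomorphic PerpMaxRel PerpMaxRel-decreasing n∸2≤2i i<j j≤n∸1
    (PerpMaxRel-represents n≤2i+2 (≤-trans (s≤s (<⇒≤ i<j)) j<n))
    (PerpMaxRel-represents (≤-trans n≤2i+2 (+-mono-≤ (s≤s (<⇒≤ i<j)) (s≤s (<⇒≤ i<j)))) j<n)
  where
  open Polar G n s t 3≤n ps
  i>0 : 0 < i
  -- From n ≥ 3 follows n ∸ 2 ≥ 1, which rules out i = 0.
  i>0 = n≢0⇒n>0 (λ { refl → <⇒≱ (∸-monoˡ-≤ 2 3≤n) n∸2≤2i })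
  j<n : suc j ≤ n
  j<n = rank≤ j≤n∸1
  n≤2i+2 : n ≤ suc i + suc i
  n≤2i+2 = n≤twice n∸2≤2i
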